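{- For all positive integers $k, n$, $AT(C_{2k+1} \square P_n) = 3$. Consequently, $C_{2k+1} \square P_n$ is chromatic-choosable, i.e. $\chi(C_{2k+1} \square P_n) = \chi_\ell(C_{2k+1} \square P_n)$.
   Context: All graphs are finite and simple, and digraphs are simple. $C_m$ denotes the cycle on $m$ vertices and $P_n$ the path on $n$ vertices. The Cartesian product $G \square H$ has vertex set $V(G)\times V(H)$, with $(u,v)$ adjacent to $(u',v')$ iff either $u=u'$ and $vv'\in E(H)$, or $v=v'$ and $uu'\in E(G)$. A circulation contained in a digraph $D$ is a spanning subdigraph $E$ of $D$ such that $d^-_E(v)=d^+_E(v)$ (indegree equals outdegree in $E$) for every $v\in V(D)$; it is even (resp. odd) if it has an even (resp. odd) number of edges (the edgeless circulation is even). The Alon-Tarsi number $AT(G)$ is the smallest $k$ for which there is an orientation $D$ of $G$ with maximum indegree $k-1$ such that the number of even circulations and the number of odd circulations contained in $D$ are different. $\chi(G)$ is the chromatic number and $\chi_\ell(G)$ is the list chromatic number: the smallest $k$ such that for every assignment $L$ of lists of colors to the vertices with $|L(v)|\ge k$ for all $v$, there is a proper coloring $f$ of $G$ with $f(v)\in L(v)$ for all $v$. A graph $G$ is chromatic-choosable if $\chi(G)=\chi_\ell(G)$. -}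

module Defs where

open import Data.Nat using (ℕ; suc; _+_; _*_; _≤_; s≤s)
open import Data.Nat.Properties using (+-monoˡ-≤; *-monoʳ-≤; 1+n≢n)
  renaming (_≟_ to _≟ℕ_)
open import Data.Nat.Divisibility using (_∣_; _∣?_)
open import Data.Fin using (Fin; toℕ)
import Data.Fin.Properties as Fin
open import Data.List using (List; []; _∷_; _++_; map; filter; length; cartesianProduct; allFin)
open import Data.List.Extrema.Nat using (max)
open import Data.List.Membership.Propositional using (_∈_)
open import Data.List.Membership.Propositional.Properties using (∈-cartesianProduct⁺; ∈-allFin)
open import Data.List.Relation.Unary.All using (all?; lookup; universal)
open import Data.List.Relation.Unary.Unique.Propositional using (Unique)
open import Data.List.Relation.Unary.Unique.Propositional.Properties
  using (cartesianProduct⁺; allFin⁺)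
open import Data.Product using (Σ; ∃; _×_; _,_; proj₁; proj₂)
open import Data.Product.Properties using (≡-dec)
open import Data.Sum using (_⊎_; inj₁; inj₂; swap; [_,_])
  renaming (map to ⊎-map)
open import Function using (_∘_; _⇔_)
open import Level using (0ℓ)
open import Relation.Binary using (Rel; Decidable; DecidableEquality; Symmetric; Asymmetric)
open import Relation.Binary.PropositionalEquality using (_≡_; _≢_; sym; trans; cong)
open import Relation.Nullary using (¬_; ¬?; Dec; _×-dec_; _⊎-dec_)
open import Relation.Nullary.Decidable using (map′)

record FiniteSet : Set₁ where
  infix 4 _≟_
  field
    Carrier  : Set
    elements : List Carrier
    unique   : Unique elements
    complete : ∀ x → x ∈ elements
    _≟_      : DecidableEquality Carrier

open FiniteSet using (Carrier; elements)

finiteFin : ℕ → FiniteSet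
finiteFin n = record
  { Carrier  = Fin n
  ; elements = allFin n
  ; unique   = allFin⁺ n
  ; complete = ∈-allFin
  ; _≟_      = Fin._≟_
  }

infixr 7 _⊗_
_⊗_ : FiniteSet → FiniteSet → FiniteSet
A ⊗ B = record
  { Carrier  = Carrier A × Carrier B
  ; elements = cartesianProduct (elements A) (elements B)
  ; unique   = cartesianProduct⁺ A.unique B.unique
  ; complete = λ (a , b) → ∈-cartesianProduct⁺ (A.complete a) (B.complete b)
  ; _≟_      = ≡-dec A._≟_ B._≟_
  }
  where
  module A = FiniteSet A
  module B = FiniteSet B

record Graph : Set₁ where
  field
    V      : FiniteSet
    Adj    : Rel (Carrier V) 0ℓ
    adj?   : Decidable Adj
    symm   : Symmetric Adj
    irrefl : ∀ v → ¬ Adj v v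

  Vertex : Set
  Vertex = Carrier V

open Graph using (Vertex)

path : ℕ → Graph
path n = record
  { V      = finiteFin n
  ; Adj    = λ i j → toℕ j ≡ suc (toℕ i) ⊎ toℕ i ≡ suc (toℕ j)
  ; adj?   = λ i j → (toℕ j ≟ℕ suc (toℕ i)) ⊎-dec (toℕ i ≟ℕ suc (toℕ j))
  ; symm   = swap
  ; irrefl = λ i → [ 1+n≢n ∘ sym , 1+n≢n ∘ sym ]
  }

-- j is the cyclic successor of i modulo m.
CyclicSucc : ∀ m → Rel (Fin m) 0ℓ
CyclicSucc m i j = toℕ j ≡ suc (toℕ i) ⊎ (suc (toℕ i) ≡ m × toℕ j ≡ 0)

cyclicSucc? : ∀ m → Decidable (CyclicSucc m)
cyclicSucc? m i j =
  (toℕ j ≟ℕ suc (toℕ i)) ⊎-dec ((suc (toℕ i) ≟ℕ m) ×-dec (toℕ j ≟ℕ 0))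

cyclicSucc-irrefl : ∀ {m} → 3 ≤ m → ∀ i → ¬ CyclicSucc m i i
cyclicSucc-irrefl 3≤m i (inj₁ p) = 1+n≢n (sym p)
cyclicSucc-irrefl (s≤s (s≤s _)) i (inj₂ (p , q)) with () ← trans (sym p) (cong suc q)

cycle : (m : ℕ) → 3 ≤ m → Graph
cycle m 3≤m = record
  { V      = finiteFin m
  ; Adj    = λ i j → CyclicSucc m i j ⊎ CyclicSucc m j i
  ; adj?   = λ i j → cyclicSucc? m i j ⊎-dec cyclicSucc? m j i
  ; symm   = swap
  ; irrefl = λ i → [ cyclicSucc-irrefl 3≤m i , cyclicSucc-irrefl 3≤m i ]
  }

3≤2k+1 : ∀ {k} → 1 ≤ k → 3 ≤ 2 * k + 1
3≤2k+1 1≤k = +-monoˡ-≤ 1 (*-monoʳ-≤ 2 1≤k)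

infixr 7 _□_
_□_ : Graph → Graph → Graph
G □ H = record
  { V      = G.V ⊗ H.V
  ; Adj    = λ (u , v) (u′ , v′) → (u ≡ u′ × H.Adj v v′) ⊎ (v ≡ v′ × G.Adj u u′)
  ; adj?   = λ (u , v) (u′ , v′) →
      (FiniteSet._≟_ G.V u u′ ×-dec H.adj? v v′) ⊎-dec
      (FiniteSet._≟_ H.V v v′ ×-dec G.adj? u u′)
  ; symm   = ⊎-map (λ (p , a) → sym p , H.symm a) (λ (p , a) → sym p , G.symm a)
  ; irrefl = λ (u , v) → [ H.irrefl v ∘ proj₂ , G.irrefl u ∘ proj₂ ]
  }
  where
  module G = Graph G
  module H = Graph H

-- All subsequences of a list.  If the list has no repetitions, each of its
-- subsets is represented exactly once.
sublists : ∀ {a} {A : Set a} → List A → List (List A)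
sublists []       = [] ∷ []
sublists (x ∷ xs) = map (x ∷_) (sublists xs) ++ sublists xs

record Digraph (V : FiniteSet) : Set₁ where
  field
    Arc    : Rel (Carrier V) 0ℓ
    arc?   : Decidable Arc
    irrefl : ∀ v → ¬ Arc v v

  arcs : List (Carrier V × Carrier V)
  arcs = filter (λ (u , v) → arc? u v) (cartesianProduct (elements V) (elements V))

-- A spanning subdigraph is given by its list E of arcs (tail , head).
module _ (V : FiniteSet) (E : List (Carrier V × Carrier V)) where
  open FiniteSet V using (_≟_; complete)

  indegree : Carrier V → ℕ
  indegree v = length (filter (λ a → proj₂ a ≟ v) E)

  outdegree : Carrier V → ℕ
  outdegree v = length (filter (λ a → proj₁ a ≟ v) E)

  IsCirculation : Set
  IsCirculation = ∀ v → indegree v ≡ outdegree v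

  isCirculation? : Dec IsCirculation
  isCirculation? = map′ (λ ps v → lookup ps (complete v)) (λ p → universal p (elements V))
    (all? (λ v → indegree v ≟ℕ outdegree v) (elements V))

module _ {V : FiniteSet} (D : Digraph V) where
  open Digraph D using (arcs)

  maxIndegree : ℕ
  maxIndegree = max 0 (map (indegree V arcs) (elements V))

  circulations : List (List (Carrier V × Carrier V))
  circulations = filter (isCirculation? V) (sublists arcs)

  #evenCirculations : ℕ
  #evenCirculations = length (filter (λ E → 2 ∣? length E) circulations)

  #oddCirculations : ℕ
  #oddCirculations = length (filter (λ E → ¬? (2 ∣? length E)) circulations)

record IsOrientation (G : Graph) (D : Digraph (Graph.V G)) : Set where
  open Graph G using (Adj)
  open Digraph D using (Arc)
  field
    adj⇔arc : ∀ u v → Adj u v ⇔ (Arc u v ⊎ Arc v u)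
    asym    : Asymmetric Arc

IsSmallest : ∀ {ℓ} → (ℕ → Set ℓ) → ℕ → Set ℓ
IsSmallest P k = P k × (∀ j → P j → k ≤ j)

HasAlonTarsiOrientation : Graph → ℕ → Set₁
HasAlonTarsiOrientation G k =
  Σ (Digraph (Graph.V G)) λ D →
    IsOrientation G D ×
    suc (maxIndegree D) ≡ k ×
    #evenCirculations D ≢ #oddCirculations D

IsAlonTarsiNumber : Graph → ℕ → Set₁
IsAlonTarsiNumber G = IsSmallest (HasAlonTarsiOrientation G)

IsProper : (G : Graph) {C : Set} → (Vertex G → C) → Set
IsProper G f = ∀ {u v} → Graph.Adj G u v → f u ≢ f v

Colorable : Graph → ℕ → Set
Colorable G k = Σ (Vertex G → Fin k) (IsProper G)

-- Colors are natural numbers; a duplicate-free list represents a finite set of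
-- colors, so its length is its cardinality.
Choosable : Graph → ℕ → Set
Choosable G k =
  (L : Vertex G → List ℕ) → (∀ v → Unique (L v)) → (∀ v → k ≤ length (L v)) →
  Σ (Vertex G → ℕ) λ f → IsProper G f × (∀ v → f v ∈ L v)

IsChromaticNumber : Graph → ℕ → Set
IsChromaticNumber G = IsSmallest (Colorable G)

IsListChromaticNumber : Graph → ℕ → Set
IsListChromaticNumber G = IsSmallest (Choosable G)

ChromaticChoosable : Graph → Set
ChromaticChoosable G = ∃ λ c → IsChromaticNumber G c × IsListChromaticNumber G c

{-# OPTIONS --safe #-}
-- The cylinder with m = 2k + 1 columns contains an odd cycle, so it is not
-- 2-colorable.  If no indegree exceeds 1, row 0 is a directed cycle that no other
-- arc enters; a circulation contains all or none of it, and toggling it matches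
-- even circulations with odd ones.
--
-- For the Alon-Tarsi orientation it suffices that the total number of circulations
-- is odd.  Direct column 0 upwards, the other columns downwards, and the rows
-- cyclically except for the arc between the ends of row 0, which is reversed.  The
-- circulations are counted modulo 2 from the last row upwards: the flow on a layer
-- of vertical arcs extends to the rows below in an odd number of ways iff it uses
-- column 0 and exactly one other column.
--
-- For 3-choosability the rows are colored one by one.  A cycle whose lists
-- are pairs, not all equal, has two different colorings, and at most one coloring
-- of a row can leave equal pairs at all vertices of the next row.

module Submission where

open import Defs
open import Algebra.Bundles using (CommutativeMonoid; CommutativeRing)
import Algebra.Properties.CommutativeSemigroup as CommutativeSemigroupProperties
open import Data.Bool using (Bool; true; false; if_then_else_; not; _∧_; _xor_)
open import Data.Bool.Properties
  using (¬-not; not-involutive; not-distribˡ-xor; not-distribʳ-xor; xor-same; xor-comm; xor-assoc;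
         xor-identityʳ; ∧-distribˡ-xor; ∧-assoc; ∧-comm; ∧-zeroʳ; ∧-identityʳ; T-≡; xor-∧-commutativeRing)
open import Data.Empty using (⊥)
open import Data.Fin using (Fin; zero; suc; toℕ; fromℕ; fromℕ<; inject₁)
open import Data.Fin.Induction using (<-weakInduction; >-weakInduction)
import Data.Fin.Properties as Fin
open import Data.Fin.Relation.Unary.Top using (view; ‵fromℕ; ‵inject₁)
open import Data.List using (List; []; _∷_; _++_; map; filter; length; concat; tabulate; upTo)
open import Data.List.Extrema.Nat using (xs≤max; max≈v⁺)
open import Data.List.Membership.Propositional using (_∈_)
import Data.List.Membership.DecPropositional as DecMembership
open import Data.List.Membership.Propositional.Properties
  using (∈-filter⁺; ∈-filter⁻; ∈-map⁺; ∈-++⁺ˡ; ∈-++⁺ʳ; ∈-++⁻; ∈-tabulate⁺; ∈-tabulate⁻; ∈-upTo⁻)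
open import Data.List.Membership.Propositional.Properties.WithK using (unique∧set⇒bag)
open import Data.List.Properties
  using (length-++; length-tabulate; length-upTo; filter-++; ++-identityʳ)
open import Data.List.Relation.Binary.BagAndSetEquality using (∼bag⇒↭)
open import Data.List.Relation.Binary.Permutation.Propositional
  using (_↭_; refl; prep; swap; ↭-sym) renaming (trans to ↭-compose)
open import Data.List.Relation.Binary.Permutation.Propositional.Properties using (↭-length; filter-↭)
open import Data.List.Relation.Unary.All as All using ([]; _∷_)
open import Data.List.Relation.Unary.All.Properties using (map⁺)
open import Data.List.Relation.Unary.AllPairs using ([]; _∷_)
open import Data.List.Relation.Unary.Any using (here; there)
open import Data.List.Relation.Unary.Unique.Propositional using (Unique)
open import Data.List.Relation.Unary.Unique.Propositional.Properties using (filter⁺; ++⁺; tabulate⁺; upTo⁺)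
open import Data.Nat using (ℕ; zero; suc; _+_; _*_; _≤_; _<?_; _≤?_; _≡ᵇ_; s≤s; z≤n)
open import Data.Nat.Divisibility using (_∣?_; ∣m+n∣m⇒∣n; ∣m∣n⇒∣m+n; ∣-refl)
open import Data.Nat.Properties
  using (m≤m+n; m≤n+m; <⇒≢; ≤-trans; ≡ᵇ⇒≡; ≡⇒≡ᵇ; +-commutativeSemigroup)
import Data.Nat.Properties as ℕ
open import Data.Product using (_×_; _,_; proj₁; proj₂; Σ; ∃-syntax) renaming (swap to reverse)
open import Data.Sum using (_⊎_; inj₁; inj₂; [_,_]′) renaming (swap to ⊎-swap)
open import Data.Vec using (Vec; []; _∷_; _∷ʳ_; lookup; replicate)
open import Data.Vec.Functional using () renaming (_∷_ to _◂_)
open import Data.Vec.Properties using (lookup-replicate)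
open import Function using (_∘_; const; id; _⇔_; mk⇔; Equivalence)
open import Relation.Binary.PropositionalEquality
  using (_≡_; _≢_; refl; sym; trans; cong; cong₂; subst; subst₂; module ≡-Reasoning)
open import Relation.Nullary using (¬_; ¬?; Dec; yes; no; does; contradiction; _×-dec_; _⊎-dec_)
open import Relation.Nullary.Decidable using (decidable-stable; map′; does-⇔; dec-true; dec-false)
open import Relation.Unary using (Decidable)

open FiniteSet using (Carrier; elements)
open CommutativeSemigroupProperties +-commutativeSemigroup using (interchange)
open CommutativeSemigroupProperties
  (CommutativeMonoid.commutativeSemigroup (CommutativeRing.+-commutativeMonoid xor-∧-commutativeRing))
  using () renaming (interchange to xor-interchange)

-- Even and odd circulations together make up an odd total, so their numbers differ; no sign and no
-- length has to be followed. Only two kinds of vertical layers matter. A circulation has net flow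
-- zero across a layer, and column 0 is the only one directed upwards, so the circulation uses no
-- arc of the layer, or column 0 and exactly one other. If row 0 were a directed cycle like the
-- other rows, it would lie below an empty layer, from which the number of extensions is even.
-- Reversing one of its arcs acts like a layer above it that carries flow in column 0 and in the
-- last column. No vertical arc enters the last vertex of row 0, so the additional arc entering
-- there keeps the indegree at 2. The Alon-Tarsi theorem would turn the orientation into
-- 3-choosability; a direct coloring argument stands in for it. Once a row is colored, at least two
-- colors remain usable at each vertex of the next one, and equal pairs around an odd cycle admit no
-- coloring. This obstacle makes "pairs, not all equal" the invariant passed from row to row.

private variable
  A : Set
  l m n : ℕ

-- Sums over sublists

bit : Bool → ℕ
bit b = if b then 1 else 0

indicator : {P : Set} → Dec P → ℕ
indicator P? = bit (does P?)

count : {P : A → Set} → Decidable P → List A → ℕ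
count P? xs = length (filter P? xs)

count-∷ : {P : A → Set} (P? : Decidable P) (x : A) (xs : List A) →
  count P? (x ∷ xs) ≡ indicator (P? x) + count P? xs
count-∷ P? x xs with P? x
... | yes _ = refl
... | no  _ = refl

count-++ : {P : A → Set} (P? : Decidable P) (xs ys : List A) →
  count P? (xs ++ ys) ≡ count P? xs + count P? ys
count-++ P? xs ys = trans (cong length (filter-++ P? xs ys)) (length-++ (filter P? xs))

count-↭ : {P : A → Set} (P? : Decidable P) {xs ys : List A} → xs ↭ ys → count P? xs ≡ count P? ys
count-↭ P? p = ↭-length (filter-↭ P? p)

count-filter : {P Q : A → Set} (P? : Decidable P) (Q? : Decidable Q) (xs : List A) →
  count Q? (filter P? xs) ≡ count (λ x → P? x ×-dec Q? x) xs
count-filter P? Q? [] = refl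
count-filter P? Q? (x ∷ xs) with P? x
... | no  _ = count-filter P? Q? xs
... | yes _ with Q? x
...   | yes _ = cong suc (count-filter P? Q? xs)
...   | no  _ = count-filter P? Q? xs

-- Summing by recursion, instead of mapping over `sublists`, lets the sum be split along `_++_` and
-- rearranged along permutations of the arc list.
sumˢ : List A → (List A → ℕ) → ℕ
sumˢ []       f = f []
sumˢ (x ∷ xs) f = sumˢ xs (f ∘ (x ∷_)) + sumˢ xs f

sumˢ-cong : (xs : List A) {f g : List A → ℕ} →
  (∀ E → (∀ {x} → x ∈ E → x ∈ xs) → f E ≡ g E) → sumˢ xs f ≡ sumˢ xs g
sumˢ-cong []       f≗g = f≗g [] (λ ())
sumˢ-cong (x ∷ xs) f≗g = cong₂ _+_
  (sumˢ-cong xs λ E E⊆ → f≗g (x ∷ E) λ { (here refl) → here refl ; (there p) → there (E⊆ p) })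
  (sumˢ-cong xs λ E E⊆ → f≗g E (there ∘ E⊆))

sumˢ-++ : (xs ys : List A) (f : List A → ℕ) →
  sumˢ (xs ++ ys) f ≡ sumˢ xs (λ E → sumˢ ys (λ F → f (E ++ F)))
sumˢ-++ []       ys f = refl
sumˢ-++ (x ∷ xs) ys f = cong₂ _+_ (sumˢ-++ xs ys (f ∘ (x ∷_))) (sumˢ-++ xs ys f)

-- Sublists of permuted lists correspond only up to permutation, so the summand must not see the
-- order of its argument.
sumˢ-↭ : {xs ys : List A} (f : List A → ℕ) → (∀ {E F} → E ↭ F → f E ≡ f F) →
  xs ↭ ys → sumˢ xs f ≡ sumˢ ys f
sumˢ-↭ f resp refl = refl
sumˢ-↭ f resp (prep x p) =
  cong₂ _+_ (sumˢ-↭ (f ∘ (x ∷_)) (resp ∘ prep x) p) (sumˢ-↭ f resp p)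
sumˢ-↭ {ys = _ ∷ _ ∷ ys} f resp (swap x y p) = trans
  (cong₂ _+_
    (cong₂ _+_
      (trans (sumˢ-↭ (λ E → f (x ∷ y ∷ E)) (resp ∘ prep x ∘ prep y) p)
             (sumˢ-cong ys λ E _ → resp (swap x y refl)))
      (sumˢ-↭ (f ∘ (x ∷_)) (resp ∘ prep x) p))
    (cong₂ _+_ (sumˢ-↭ (f ∘ (y ∷_)) (resp ∘ prep y) p) (sumˢ-↭ f resp p)))
  -- The sublists with x alone and those with y alone trade places.
  (interchange (sumˢ ys _) (sumˢ ys _) (sumˢ ys _) (sumˢ ys _))
sumˢ-↭ f resp (↭-compose p q) = trans (sumˢ-↭ f resp p) (sumˢ-↭ f resp q)

count-map : {B : Set} {P : B → Set} (P? : Decidable P) (f : A → B) (xs : List A) →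
  count P? (map f xs) ≡ count (P? ∘ f) xs
count-map P? f [] = refl
count-map P? f (x ∷ xs) with does (P? (f x))
... | true  = cong suc (count-map P? f xs)
... | false = count-map P? f xs

count-sublists : {P : List A → Set} (P? : Decidable P) (xs : List A) →
  count P? (sublists xs) ≡ sumˢ xs (indicator ∘ P?)
count-sublists P? [] = trans (count-∷ P? [] []) (ℕ.+-identityʳ _)
count-sublists P? (x ∷ xs) = trans
  (count-++ P? (map (x ∷_) (sublists xs)) (sublists xs))
  (cong₂ _+_
    (trans (count-map P? (x ∷_) (sublists xs)) (count-sublists (P? ∘ (x ∷_)) xs))
    (count-sublists P? xs))

-- Sublists encoded by bit vectors

select : Vec Bool m → (Fin m → A) → List A
select []          a = []
select (true  ∷ b) a = a zero ∷ select b (a ∘ suc)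
select (false ∷ b) a = select b (a ∘ suc)

count-select-none : {P : A → Set} (P? : Decidable P) (b : Vec Bool m) (a : Fin m → A) →
  (∀ i → ¬ P (a i)) → count P? (select b a) ≡ 0
count-select-none P? []      a none = refl
count-select-none P? (false ∷ b) a none = count-select-none P? b (a ∘ suc) (none ∘ suc)
count-select-none P? (true ∷ b) a none with P? (a zero)
... | yes p = contradiction p (none zero)
... | no  _ = count-select-none P? b (a ∘ suc) (none ∘ suc)

-- Meant for degrees: when exactly one arc of a family meets a vertex, the family contributes the
-- bit of that arc.
count-select-one : {P : A → Set} (P? : Decidable P) (b : Vec Bool m) (a : Fin m → A) (i : Fin m) →
  P (a i) → (∀ j → P (a j) → j ≡ i) → count P? (select b a) ≡ bit (lookup b i)
count-select-one P? (x ∷ b) a zero p only = trans (head x) (trans (cong (bit x +_)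
    (count-select-none P? b (a ∘ suc) (λ j q → contradiction (only (suc j) q) λ ())))
    (ℕ.+-identityʳ _))
  where
  head : ∀ x → count P? (select (x ∷ b) a) ≡ bit x + count P? (select b (a ∘ suc))
  head false = refl
  head true with P? (a zero)
  ... | yes _ = refl
  ... | no ¬p = contradiction p ¬p
count-select-one P? (x ∷ b) a (suc i) p only = trans (head x)
    (count-select-one P? b (a ∘ suc) i p λ j q → Fin.suc-injective (only (suc j) q))
  where
  head : ∀ x → count P? (select (x ∷ b) a) ≡ count P? (select b (a ∘ suc))
  head false = refl
  head true with P? (a zero)
  ... | yes q = contradiction (only zero q) λ ()
  ... | no  _ = refl

select₂ : Vec (Vec Bool m) n → (Fin n → Fin m → A) → List A
select₂ []       a = []
select₂ (b ∷ bs) a = select b (a zero) ++ select₂ bs (a ∘ suc)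

count-select₂-none : {P : A → Set} (P? : Decidable P) (bs : Vec (Vec Bool m) n) (a : Fin n → Fin m → A) →
  (∀ r i → ¬ P (a r i)) → count P? (select₂ bs a) ≡ 0
count-select₂-none P? []       a none = refl
count-select₂-none P? (b ∷ bs) a none = trans
  (count-++ P? (select b (a zero)) (select₂ bs (a ∘ suc)))
  (cong₂ _+_ (count-select-none P? b (a zero) (none zero))
             (count-select₂-none P? bs (a ∘ suc) (none ∘ suc)))

count-select₂-row : {P : A → Set} (P? : Decidable P) (bs : Vec (Vec Bool m) n) (a : Fin n → Fin m → A)
  (r : Fin n) → (∀ s i → P (a s i) → s ≡ r) →
  count P? (select₂ bs a) ≡ count P? (select (lookup bs r) (a r))
count-select₂-row P? (b ∷ bs) a zero only = trans
  (count-++ P? (select b (a zero)) (select₂ bs (a ∘ suc)))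
  (trans (cong (count P? (select b (a zero)) +_)
           (count-select₂-none P? bs (a ∘ suc) λ s i q → contradiction (only (suc s) i q) λ ()))
         (ℕ.+-identityʳ _))
count-select₂-row P? (b ∷ bs) a (suc r) only = trans
  (count-++ P? (select b (a zero)) (select₂ bs (a ∘ suc)))
  (cong₂ _+_ (count-select-none P? b (a zero) λ i q → contradiction (only zero i q) λ ())
             (count-select₂-row P? bs (a ∘ suc) r λ s i q → Fin.suc-injective (only (suc s) i q)))

table : (Fin n → Fin m → A) → List A
table a = concat (tabulate λ r → tabulate (a r))

-- The operation is a parameter because the same sum is taken in the natural numbers and, as `⊕`,
-- modulo 2.
sumᵛ : {X : Set} → (X → X → X) → ∀ m → (Vec Bool m → X) → X
sumᵛ _∙_ zero    f = f []
sumᵛ _∙_ (suc m) f = sumᵛ _∙_ m (f ∘ (true ∷_)) ∙ sumᵛ _∙_ m (f ∘ (false ∷_))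

sumˢ-tabulate : (a : Fin m → A) (f : List A → ℕ) →
  sumˢ (tabulate a) f ≡ sumᵛ _+_ m (λ b → f (select b a))
sumˢ-tabulate {m = zero}  a f = refl
sumˢ-tabulate {m = suc m} a f = cong₂ _+_
  (sumˢ-tabulate (a ∘ suc) (f ∘ (a zero ∷_))) (sumˢ-tabulate (a ∘ suc) f)

select-all : (a : Fin m → A) → select (replicate m true) a ≡ tabulate a
select-all {m = zero}  a = refl
select-all {m = suc m} a = cong (a zero ∷_) (select-all (a ∘ suc))

select₂-all : (a : Fin n → Fin m → A) → select₂ (replicate n (replicate m true)) a ≡ table a
select₂-all {n = zero}  a = refl
select₂-all {n = suc n} a = cong₂ _++_ (select-all (a zero)) (select₂-all (a ∘ suc))

-- Cyclic rows

next : Fin (suc l) → Fin (suc l)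
next {l} i with suc (toℕ i) <? suc l
... | yes i<l = fromℕ< i<l
... | no  _   = zero

prev : Fin (suc l) → Fin (suc l)
prev {l} zero = fromℕ l
prev (suc i)  = inject₁ i

next-succ : (i : Fin (suc l)) → CyclicSucc (suc l) i (next i)
next-succ {l} i with suc (toℕ i) <? suc l
... | yes i<l = inj₁ (Fin.toℕ-fromℕ< i<l)
... | no  i≮l = inj₂ (ℕ.≤-antisym (Fin.toℕ<n i) (ℕ.≮⇒≥ i≮l) , refl)

cyclicSucc-functional : ∀ {i j j′ : Fin l} → CyclicSucc l i j → CyclicSucc l i j′ → j ≡ j′
cyclicSucc-functional {j = j} {j′} (inj₁ p) (inj₁ q) = Fin.toℕ-injective (trans p (sym q))
cyclicSucc-functional {j = j} {j′} (inj₁ p) (inj₂ (q , _)) = contradiction (trans p q) (ℕ.<⇒≢ (Fin.toℕ<n j))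
cyclicSucc-functional {j = j} {j′} (inj₂ (q , _)) (inj₁ p) = contradiction (trans p q) (ℕ.<⇒≢ (Fin.toℕ<n j′))
cyclicSucc-functional {j = j} {j′} (inj₂ (_ , p)) (inj₂ (_ , q)) = Fin.toℕ-injective (trans p (sym q))

cyclicSucc-injective : ∀ {i i′ j : Fin l} → CyclicSucc l i j → CyclicSucc l i′ j → i ≡ i′
cyclicSucc-injective (inj₁ p) (inj₁ q) = Fin.toℕ-injective (ℕ.suc-injective (trans (sym p) q))
cyclicSucc-injective (inj₁ p) (inj₂ (_ , q)) = contradiction (trans (sym p) q) λ ()
cyclicSucc-injective (inj₂ (_ , p)) (inj₁ q) = contradiction (trans (sym q) p) λ ()
cyclicSucc-injective (inj₂ (p , _)) (inj₂ (q , _)) = Fin.toℕ-injective (ℕ.suc-injective (trans p (sym q)))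

prev-succ : (i : Fin (suc l)) → CyclicSucc (suc l) (prev i) i
prev-succ {l} zero = inj₂ (cong suc (Fin.toℕ-fromℕ l) , refl)
prev-succ (suc i)  = inj₁ (cong suc (sym (Fin.toℕ-inject₁ i)))

next-prev : (i : Fin (suc l)) → next (prev i) ≡ i
next-prev i = cyclicSucc-functional (next-succ (prev i)) (prev-succ i)

prev-next : (i : Fin (suc l)) → prev (next i) ≡ i
prev-next i = cyclicSucc-injective (prev-succ (next i)) (next-succ i)

next-injective : {i j : Fin (suc l)} → next i ≡ next j → i ≡ j
next-injective {i = i} {j} p = trans (sym (prev-next i)) (trans (cong prev p) (prev-next j))

inject₁-next : (i : Fin l) → next (inject₁ i) ≡ suc i
inject₁-next i = next-prev (suc i)

fromℕ-next : next (fromℕ l) ≡ zero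
fromℕ-next = next-prev zero

module _ {a} (P : Fin (suc l) → Set a) where

  -- Climbing from i to the last element and wrapping around reaches zero, and climbing from zero
  -- reaches every j.
  next-orbit : (∀ {i} → P i → P (next i)) → ∀ {i} j → P i → P j
  next-orbit step {i} j p =
    <-weakInduction P (to-zero p) (λ i → subst P (inject₁-next i) ∘ step) j
    where
    to-zero : P i → P zero
    to-zero = >-weakInduction (λ i → P i → P zero)
      (subst P fromℕ-next ∘ step)
      (λ i rec p → rec (subst P (inject₁-next i) (step p))) i

-- Apply `next-orbit` to the property that P i implies P j, starting from j, where it is trivial.
prev-orbit : ∀ {a} (P : Fin (suc l) → Set a) → (∀ {i} → P (next i) → P i) → ∀ {i} j → P i → P j
prev-orbit P step {i} j = next-orbit (λ i → P i → P j) (λ f → f ∘ step) i (λ p → p)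

odd : ℕ → Bool
odd zero    = false
odd (suc n) = not (odd n)

-- The values alternate from zero up to the last vertex; its index is even, so both ends of the
-- closing edge agree.
odd-cycle-not-bicolorable : odd l ≡ false → (f : Fin (suc l) → Bool) →
  (∀ i → f i ≢ f (next i)) → ∀ {a} {A : Set a} → A
odd-cycle-not-bicolorable {l} even f proper = contradiction
  (trans (alternates (fromℕ l)) (trans (cong (f zero xor_) (trans (cong odd (Fin.toℕ-fromℕ l)) even))
    (trans (xor-identityʳ (f zero)) (cong f (sym fromℕ-next)))))
  (proper (fromℕ l))
  where
  alternates : ∀ i → f i ≡ f zero xor odd (toℕ i)
  alternates = <-weakInduction _ (sym (xor-identityʳ (f zero))) λ i eq → begin
    f (suc i)                            ≡⟨ cong f (inject₁-next i) ⟨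
    f (next (inject₁ i))                 ≡⟨ ¬-not (proper (inject₁ i) ∘ sym) ⟩
    not (f (inject₁ i))                  ≡⟨ cong not eq ⟩
    not (f zero xor odd (toℕ (inject₁ i))) ≡⟨ cong (λ j → not (f zero xor odd j)) (Fin.toℕ-inject₁ i) ⟩
    not (f zero xor odd (toℕ i))         ≡⟨ not-distribʳ-xor (f zero) (odd (toℕ i)) ⟩
    f zero xor odd (suc (toℕ i))         ∎
    where open ≡-Reasoning

-- List colorings of cylinders

record Pair : Set where
  constructor pair
  field
    fst snd : ℕ
    fst≢snd : fst ≢ snd

infix 4 _∈ᵖ_ _∉ᵖ_ _∈ᵖ?_
_∈ᵖ_ _∉ᵖ_ : ℕ → Pair → Set
x ∈ᵖ pair a b _ = x ≡ a ⊎ x ≡ b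
x ∉ᵖ p = ¬ x ∈ᵖ p

_∈ᵖ?_ : ∀ x p → Dec (x ∈ᵖ p)
x ∈ᵖ? pair a b _ = (x ℕ.≟ a) ⊎-dec (x ℕ.≟ b)

other : ∀ p x → ∃[ y ] y ∈ᵖ p × y ≢ x
other (pair a b a≢b) x with a ℕ.≟ x
... | yes refl = b , inj₂ refl , a≢b ∘ sym
... | no  a≢x  = a , inj₁ refl , a≢x

pair-⊆ : ∀ {x y p q} → x ≢ y → x ∈ᵖ p → y ∈ᵖ p → x ∈ᵖ q → y ∈ᵖ q → ∀ {z} → z ∈ᵖ p → z ∈ᵖ q
pair-⊆ x≢y (inj₁ refl) (inj₁ refl) xq yq z = contradiction refl x≢y
pair-⊆ x≢y (inj₂ refl) (inj₂ refl) xq yq z = contradiction refl x≢y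
pair-⊆ x≢y (inj₁ refl) (inj₂ refl) xq yq (inj₁ refl) = xq
pair-⊆ x≢y (inj₁ refl) (inj₂ refl) xq yq (inj₂ refl) = yq
pair-⊆ x≢y (inj₂ refl) (inj₁ refl) xq yq (inj₁ refl) = yq
pair-⊆ x≢y (inj₂ refl) (inj₁ refl) xq yq (inj₂ refl) = xq

-- Pairs have equal size, so an inclusion of q in p would be an equality and force c into q.
pair-⊈ : ∀ {c p q} → c ∈ᵖ p → c ∉ᵖ q → ∃[ d ] d ∈ᵖ q × d ∉ᵖ p
pair-⊈ {p = p} {q = q@(pair a b a≢b)} c∈p c∉q with a ∈ᵖ? p | b ∈ᵖ? p
... | no  a∉p | _       = a , inj₁ refl , a∉p
... | yes _   | no  b∉p = b , inj₂ refl , b∉p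
... | yes a∈p | yes b∈p =
  contradiction (pair-⊆ {p = p} {q = q} a≢b a∈p b∈p (inj₁ refl) (inj₂ refl) c∈p) c∉q

-- Colorings of paths and cycles from lists of two colors

IsPathColoring : (Fin (suc l) → Pair) → (Fin (suc l) → ℕ) → Set
IsPathColoring P f = (∀ i → f i ∈ᵖ P i) × (∀ i → f (inject₁ i) ≢ f (suc i))

_Differs_ : (f g : Fin l → ℕ) → Set
f Differs g = ∃[ i ] f i ≢ g i

◂-coloring : ∀ {P : Fin (suc (suc l)) → Pair} {x f} → x ∈ᵖ P zero → x ≢ f zero →
  IsPathColoring (P ∘ suc) f → IsPathColoring P (x ◂ f)
◂-coloring x∈P x≢f (f∈P , proper) =
  (λ { zero → x∈P ; (suc i) → f∈P i }) , (λ { zero → x≢f ; (suc i) → proper i })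

-- Color greedily from x and look for a deviation from t. Where t i is not in the pair at i+1, both
-- colors there are free and one of them deviates. Hence t is forced only if every t i lies in the
-- next pair, which is what the second alternative records.
pathColoring-from : (P : Fin (suc l) → Pair) (t : Fin (suc l) → ℕ) {x : ℕ} → x ∈ᵖ P zero →
  (∃[ f ] IsPathColoring P f × f zero ≡ x × f Differs t)
  ⊎ (t zero ≡ x × IsPathColoring P t × (∀ i → t (inject₁ i) ∈ᵖ P (suc i)))
pathColoring-from {zero} P t {x} x∈P with t zero ℕ.≟ x
... | yes t≡x = inj₂ (t≡x , ((λ { zero → subst (_∈ᵖ P zero) (sym t≡x) x∈P }) , λ ()) , λ ())
... | no  t≢x = inj₁ (const x , ((λ { zero → x∈P }) , λ ()) , refl , zero , t≢x ∘ sym)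
pathColoring-from {suc l} P t {x} x∈P with other (P (suc zero)) x
... | y , y∈P , y≢x with pathColoring-from (P ∘ suc) (t ∘ suc) y∈P
...   | inj₁ (f , path , f≡y , i , f≢t) = inj₁
        ( x ◂ f , ◂-coloring {P = P} x∈P (λ eq → y≢x (trans (sym f≡y) (sym eq))) path
        , refl , suc i , f≢t)
...   | inj₂ (t≡y , path , t∈P) with t zero ℕ.≟ x | x ∈ᵖ? P (suc zero)
...     | no  t≢x | _ = inj₁
          ( x ◂ t ∘ suc , ◂-coloring {P = P} x∈P (λ eq → y≢x (trans (sym t≡y) (sym eq))) path
          , refl , zero , t≢x ∘ sym)
...     | yes t≡x | yes x∈P₁ = inj₂
          ( t≡x
          , ( (λ { zero → subst (_∈ᵖ P zero) (sym t≡x) x∈P ; (suc i) → proj₁ path i })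
            , λ { zero eq → y≢x (trans (sym t≡y) (trans (sym eq) t≡x)) ; (suc i) → proj₂ path i })
          , λ { zero → subst (_∈ᵖ P (suc zero)) (sym t≡x) x∈P₁ ; (suc i) → t∈P i })
...     | yes t≡x | no  x∉P₁ with other (P (suc zero)) (t (suc zero))
...       | z , z∈P , z≢t with pathColoring-from (P ∘ suc) (t ∘ suc) z∈P
...         | inj₁ (f , path′ , f≡z , i , f≢t) = inj₁
              ( x ◂ f
              , ◂-coloring {P = P} x∈P (λ eq → x∉P₁ (subst (_∈ᵖ P (suc zero)) (sym (trans eq f≡z)) z∈P)) path′
              , refl , suc i , f≢t)
...         | inj₂ (t≡z , _) = contradiction (sym t≡z) z≢t

-- The mirror image, with the last color prescribed. The recursion still peels off the first vertex,
-- which is now colored last and has only one color to avoid.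
pathColoring-to : (P : Fin (suc l) → Pair) (t : Fin (suc l) → ℕ) {x : ℕ} → x ∈ᵖ P (fromℕ l) →
  (∃[ f ] IsPathColoring P f × f (fromℕ l) ≡ x × f Differs t)
  ⊎ (IsPathColoring P t × t (fromℕ l) ≡ x × (∀ i → t (suc i) ∈ᵖ P (inject₁ i)))
pathColoring-to {zero} P t {x} x∈P with t zero ℕ.≟ x
... | yes t≡x = inj₂ (((λ { zero → subst (_∈ᵖ P zero) (sym t≡x) x∈P }) , λ ()) , t≡x , λ ())
... | no  t≢x = inj₁ (const x , ((λ { zero → x∈P }) , λ ()) , refl , zero , t≢x ∘ sym)
pathColoring-to {suc l} P t x∈P with pathColoring-to (P ∘ suc) (t ∘ suc) x∈P
... | inj₁ (f , path , f≡x , i , f≢t) with other (P zero) (f zero)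
...   | y , y∈P , y≢f = inj₁ (y ◂ f , ◂-coloring {P = P} y∈P y≢f path , f≡x , suc i , f≢t)
pathColoring-to {suc l} P t x∈P | inj₂ (path , t≡x , t∈P) with other (P zero) (t (suc zero))
... | y , y∈P , y≢t with y ℕ.≟ t zero | t (suc zero) ∈ᵖ? P zero
...   | no  y≢t₀ | _ = inj₁ (y ◂ t ∘ suc , ◂-coloring {P = P} y∈P y≢t path , t≡x , zero , y≢t₀)
...   | yes y≡t₀ | yes t₁∈P = inj₂
        ( ( (λ { zero → subst (_∈ᵖ P zero) y≡t₀ y∈P ; (suc i) → proj₁ path i })
          , λ { zero eq → y≢t (trans y≡t₀ eq) ; (suc i) → proj₂ path i })
        , t≡x , λ { zero → t₁∈P ; (suc i) → t∈P i })
...   | yes _ | no  t₁∉P with other (P zero) (t zero)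
...     | z , z∈P , z≢t₀ = inj₁
          ( z ◂ t ∘ suc
          , ◂-coloring {P = P} z∈P (λ eq → t₁∉P (subst (_∈ᵖ P zero) eq z∈P)) path
          , t≡x , zero , z≢t₀)

IsCycleColoring : (Fin (suc l) → Pair) → (Fin (suc l) → ℕ) → Set
IsCycleColoring P f = (∀ i → f i ∈ᵖ P i) × (∀ i → f i ≢ f (next i))

close-path : {P : Fin (suc l) → Pair} {f : Fin (suc l) → ℕ} → IsPathColoring P f →
  f (fromℕ l) ≢ f zero → IsCycleColoring P f
close-path {f = f} (f∈P , proper) closing = f∈P , λ i →
  subst (λ j → f j ≢ f (next i)) (prev-next i) (properᵖ (next i))
  where
  properᵖ : ∀ j → f (prev j) ≢ f j
  properᵖ zero    = closing
  properᵖ (suc i) = proper i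

-- Greedy colorings from a color of P₀ missing from Pₗ, and towards a color of
-- Pₗ missing from P₀, close up.  If neither has a choice that leads away from t,
-- then consecutive pairs are both equal to {tᵢ, tᵢ₊₁}, so all pairs are equal.
secondColoring-wrap : (P : Fin (suc l) → Pair) {c : ℕ} → c ∈ᵖ P (fromℕ l) → c ∉ᵖ P zero →
  (t : Fin (suc l) → ℕ) → ∃[ f ] IsCycleColoring P f × f Differs t
secondColoring-wrap {l} P {c} c∈P c∉P t with pair-⊈ {p = P (fromℕ l)} {P zero} c∈P c∉P
... | d , d∈P , d∉P with pathColoring-from P t d∈P | pathColoring-to P t c∈P
...   | inj₁ (f , path , f≡d , differs) | _ =
        f , close-path {P = P} path
              (λ eq → d∉P (subst (_∈ᵖ P (fromℕ l)) (trans eq f≡d) (proj₁ path (fromℕ l)))) , differs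
...   | inj₂ _ | inj₁ (f , path , f≡c , differs) =
        f , close-path {P = P} path
              (λ eq → c∉P (subst (_∈ᵖ P zero) (trans (sym eq) f≡c) (proj₁ path zero))) , differs
...   | inj₂ (_ , (t∈P , proper) , t∈P⁺) | inj₂ (_ , _ , t∈P⁻) = contradiction
        (>-weakInduction (λ i → c ∈ᵖ P i) c∈P
          (λ i → pair-⊆ {p = P (suc i)} {P (inject₁ i)} (proper i)
                   (t∈P⁺ i) (t∈P (suc i)) (t∈P (inject₁ i)) (t∈P⁻ i))
          zero)
        c∉P

NonConstant : (Fin (suc l) → Pair) → Set
NonConstant P = ∃[ i ] ∃[ c ] c ∈ᵖ P i × c ∉ᵖ P (next i)

-- Rotating the cycle moves a place where consecutive pairs differ to the closing edge, where
-- `secondColoring-wrap` applies.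
secondColoring : (P : Fin (suc l) → Pair) → NonConstant P →
  (t : Fin (suc l) → ℕ) → ∃[ f ] IsCycleColoring P f × f Differs t
secondColoring {l} P (i , edge) =
  prev-orbit Goal (λ {i} → rotate i) {fromℕ l} i
    (λ P (c , c∈P , c∉P) → secondColoring-wrap P c∈P (subst (λ j → c ∉ᵖ P j) fromℕ-next c∉P))
    P edge
  where
  Goal : Fin (suc l) → Set
  Goal i = (P : Fin (suc l) → Pair) → (∃[ c ] c ∈ᵖ P i × c ∉ᵖ P (next i)) →
    (t : Fin (suc l) → ℕ) → ∃[ f ] IsCycleColoring P f × f Differs t
  rotate : ∀ i → Goal (next i) → Goal i
  rotate i goal P (c , c∈P , c∉P) t with goal (P ∘ prev)
    ( c , subst (λ j → c ∈ᵖ P j) (sym (prev-next i)) c∈P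
        , c∉P ∘ subst (λ j → c ∈ᵖ P j) (prev-next (next i)))
    (t ∘ prev)
  ... | f , (f∈P , proper) , j , f≢t = f ∘ next
    , ((λ i → subst (λ j → f (next i) ∈ᵖ P j) (prev-next i) (f∈P (next i))) , proper ∘ next)
    , prev j , λ eq → f≢t (trans (cong f (sym (next-prev j))) eq)

-- Lists of three colors and the pairs that a colored row leaves

record Triple : Set where
  constructor triple
  field
    fst snd thd : ℕ
    fst≢snd : fst ≢ snd
    fst≢thd : fst ≢ thd
    snd≢thd : snd ≢ thd

infix 4 _∈ᵗ_
_∈ᵗ_ : ℕ → Triple → Set
x ∈ᵗ triple a b c _ _ _ = x ≡ a ⊎ x ≡ b ⊎ x ≡ c

_∈ᵗ?_ : ∀ x p → Dec (x ∈ᵗ p)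
x ∈ᵗ? triple a b c _ _ _ = (x ℕ.≟ a) ⊎-dec (x ℕ.≟ b) ⊎-dec (x ℕ.≟ c)

remove : Triple → ℕ → Pair
remove (triple a b c a≢b a≢c b≢c) x with a ℕ.≟ x | b ℕ.≟ x
... | yes _ | _     = pair b c b≢c
... | no _  | yes _ = pair a c a≢c
-- Also reached when x is not in the triple; dropping c is then an arbitrary choice.
... | no _  | no _  = pair a b a≢b

remove-⊆ : ∀ t x {y} → y ∈ᵖ remove t x → y ∈ᵗ t
remove-⊆ (triple a b c _ _ _) x y∈ with a ℕ.≟ x | b ℕ.≟ x | y∈
... | yes _ | _     | y∈ = inj₂ y∈
... | no _  | yes _ | inj₁ p = inj₁ p
... | no _  | yes _ | inj₂ p = inj₂ (inj₂ p)
... | no _  | no _  | inj₁ p = inj₁ p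
... | no _  | no _  | inj₂ p = inj₂ (inj₁ p)

remove-∉ : ∀ t x → x ∉ᵖ remove t x
remove-∉ (triple a b c a≢b a≢c b≢c) x x∈ with a ℕ.≟ x | b ℕ.≟ x | x∈
... | yes refl | _     | inj₁ p = a≢b p
... | yes refl | _     | inj₂ p = a≢c p
... | no a≢x | yes refl | inj₁ p = a≢x (sym p)
... | no _ | yes refl | inj₂ p = b≢c p
... | no a≢x  | no b≢x  | inj₁ p = a≢x (sym p)
... | no a≢x  | no b≢x  | inj₂ p = b≢x (sym p)

remove-keeps : ∀ t x {y} → x ∈ᵗ t → y ∈ᵗ t → y ≢ x → y ∈ᵖ remove t x
remove-keeps (triple a b c a≢b a≢c b≢c) x x∈ y∈ y≢x with a ℕ.≟ x | b ℕ.≟ x | y∈ | x∈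
... | yes refl | _ | inj₁ refl | _ = contradiction refl y≢x
... | yes refl | _ | inj₂ p    | _ = p
... | no _ | yes refl | inj₁ p | _ = inj₁ p
... | no _ | yes refl | inj₂ (inj₁ p) | _ = contradiction p y≢x
... | no _ | yes refl | inj₂ (inj₂ p) | _ = inj₂ p
... | no _   | no _   | inj₁ p | _ = inj₁ p
... | no _   | no _   | inj₂ (inj₁ p) | _ = inj₂ p
... | no a≢x | no b≢x | inj₂ (inj₂ p) | inj₁ q = contradiction (sym q) a≢x
... | no a≢x | no b≢x | inj₂ (inj₂ p) | inj₂ (inj₁ q) = contradiction (sym q) b≢x
... | no a≢x | no b≢x | inj₂ (inj₂ p) | inj₂ (inj₂ q) = contradiction (trans p (sym q)) y≢x

-- The pair p cannot contain all three colors of the triple.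
alternative : ∀ t p → ∃[ q ] ∃[ y ] y ∈ᵖ q × y ∉ᵖ p × (∀ {z} → z ∈ᵖ q → z ∈ᵗ t)
alternative (triple a b c a≢b a≢c b≢c) p with a ∈ᵖ? p | b ∈ᵖ? p
... | no a∉p  | _ = pair a b a≢b , a , inj₁ refl , a∉p , λ { (inj₁ q) → inj₁ q ; (inj₂ q) → inj₂ (inj₁ q) }
... | yes a∈p | no b∉p = pair a b a≢b , b , inj₂ refl , b∉p , λ { (inj₁ q) → inj₁ q ; (inj₂ q) → inj₂ (inj₁ q) }
... | yes a∈p | yes b∈p = pair a c a≢c , c , inj₂ refl
    , (λ c∈p → contradiction (pair-⊆ {p = p} {q = pair a b a≢b} a≢b a∈p b∈p (inj₁ refl) (inj₂ refl) c∈p)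
                 λ { (inj₁ q) → a≢c (sym q) ; (inj₂ q) → b≢c (sym q) })
    , λ { (inj₁ q) → inj₁ q ; (inj₂ q) → inj₂ (inj₂ q) }

-- Every choice of colors from the pairs P respects the lists M and the coloring f of the row above.
Residual : (Fin (suc l) → Triple) → (Fin (suc l) → ℕ) → (Fin (suc l) → Pair) → Set
Residual M f P = (∀ i {x} → x ∈ᵖ P i → x ∈ᵗ M i) × (∀ i → f i ∉ᵖ P i)

-- The bad case: every list loses a color to f, and what remains is the same pair everywhere.
Blocks : (Fin (suc l) → ℕ) → (Fin (suc l) → Triple) → Set
Blocks f M = (∀ i → f i ∈ᵗ M i) × (∀ i j {x} → x ∈ᵖ remove (M i) (f i) → x ∈ᵖ remove (M j) (f j))

⊆ᵖ⇒⊆ : ∀ {p q} → Pair.fst p ∈ᵖ q × Pair.snd p ∈ᵖ q → ∀ {x} → x ∈ᵖ p → x ∈ᵖ q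
⊆ᵖ⇒⊆ (a , b) (inj₁ refl) = a
⊆ᵖ⇒⊆ (a , b) (inj₂ refl) = b

_⊆ᵖ?_ : ∀ p q → Dec (∀ {x} → x ∈ᵖ p → x ∈ᵖ q)
p ⊆ᵖ? q = map′ (⊆ᵖ⇒⊆ {p} {q}) (λ sub → sub (inj₁ refl) , sub (inj₂ refl))
  ((Pair.fst p ∈ᵖ? q) ×-dec (Pair.snd p ∈ᵖ? q))

⊈-witness : ∀ {p q} → ¬ (∀ {x} → x ∈ᵖ p → x ∈ᵖ q) → ∃[ c ] c ∈ᵖ p × c ∉ᵖ q
⊈-witness {p} {q} nsub with Pair.fst p ∈ᵖ? q
... | no  a∉q = _ , inj₁ refl , a∉q
... | yes a∈q = _ , inj₂ refl , λ b∈q → nsub (⊆ᵖ⇒⊆ {p} {q} (a∈q , b∈q))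

next-≢ : 1 ≤ l → (i : Fin (suc l)) → next i ≢ i
next-≢ {l} 1≤l i = go (next-succ i)
  where
  go : ∀ {j} → CyclicSucc (suc l) i j → j ≢ i
  go (inj₁ p) refl = ℕ.1+n≢n (sym p)
  go (inj₂ (p , q)) refl = contradiction (trans (sym (ℕ.suc-injective p)) q) (ℕ.m<n⇒n≢0 1≤l)

change : (P : Fin (suc l) → Pair) (i : Fin (suc l)) (q : Pair) → Fin (suc l) → Pair
change P i q j with i Fin.≟ j
... | yes _ = q
... | no  _ = P j

change-at : (P : Fin (suc l) → Pair) (i : Fin (suc l)) (q : Pair) → change P i q i ≡ q
change-at P i q with i Fin.≟ i
... | yes _  = refl
... | no i≢i = contradiction refl i≢i

change-off : (P : Fin (suc l) → Pair) (i : Fin (suc l)) (q : Pair) {j : Fin (suc l)} → i ≢ j → change P i q j ≡ P j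
change-off P i q {j} i≢j with i Fin.≟ j
... | yes i≡j = contradiction i≡j i≢j
... | no _    = refl

-- The remainders serve unless they are all equal. If they are and some list misses the color above
-- it, its whole triple is free, and exchanging its pair for one with a new color breaks the
-- equality.
residual : 1 ≤ l → (M : Fin (suc l) → Triple) (f : Fin (suc l) → ℕ) →
  (∃[ P ] NonConstant P × Residual M f P) ⊎ Blocks f M
residual {l} 1≤l M f = split (Fin.any? λ i → ¬? (P i ⊆ᵖ? P (next i)))
  where
  P : Fin (suc l) → Pair
  P i = remove (M i) (f i)
  P⊆M : ∀ i {x} → x ∈ᵖ P i → x ∈ᵗ M i
  P⊆M i = remove-⊆ (M i) (f i)
  f∉P : ∀ i → f i ∉ᵖ P i
  f∉P i = remove-∉ (M i) (f i)
  Result : Set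
  Result = (∃[ Q ] NonConstant Q × Residual M f Q) ⊎ Blocks f M
  exchange : (∀ {i x} → x ∈ᵖ P i → x ∈ᵖ P (next i)) → ∀ i → ¬ f i ∈ᵗ M i →
    (∃[ q ] ∃[ y ] y ∈ᵖ q × y ∉ᵖ P i × (∀ {z} → z ∈ᵖ q → z ∈ᵗ M i)) → Result
  exchange ⊆next i f∉M (q , y , y∈q , y∉P , q⊆M) = inj₁
    ( change P i q
    , (i , y , subst (y ∈ᵖ_) (sym (change-at P i q)) y∈q
           -- The next vertex keeps its old pair; if y were in it, y would travel around the cycle
           -- back into the old pair at i.
           , λ y∈ → y∉P (next-orbit (λ k → y ∈ᵖ P k) ⊆next i
               (subst (y ∈ᵖ_) (change-off P i q (next-≢ 1≤l i ∘ sym)) y∈)))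
    , (λ j → cases (i Fin.≟ j) (λ p → ∀ {x} → x ∈ᵖ p → x ∈ᵗ M j) (λ { refl → q⊆M }) (P⊆M j))
    , (λ j → cases (i Fin.≟ j) (f j ∉ᵖ_) (λ { refl → f∉M ∘ q⊆M }) (f∉P j)))
    where
    cases : ∀ {j} → Dec (i ≡ j) → (R : Pair → Set) → (i ≡ j → R q) → R (P j) → R (change P i q j)
    cases (yes refl) R at off = subst R (sym (change-at P i q)) (at refl)
    cases (no i≢j)   R at off = subst R (sym (change-off P i q i≢j)) off
  constant : (∀ {i x} → x ∈ᵖ P i → x ∈ᵖ P (next i)) → Dec (∃[ i ] ¬ f i ∈ᵗ M i) → Result
  constant ⊆next (yes (i , f∉M)) = exchange ⊆next i f∉M (alternative (M i) (P i))
  constant ⊆next (no f∈M) = inj₂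
    ( (λ i → decidable-stable (f i ∈ᵗ? M i) λ f∉M → f∈M (i , f∉M))
    , λ i j {x} → next-orbit (λ k → x ∈ᵖ P k) ⊆next {i} j)
  split : Dec (∃[ i ] ¬ (∀ {x} → x ∈ᵖ P i → x ∈ᵖ P (next i))) → Result
  split (yes (i , ⊈next)) = inj₁ (P , (i , ⊈-witness {P i} {P (next i)} ⊈next) , P⊆M , f∉P)
  split (no ⊆next) = constant
    (λ {i} → decidable-stable (P i ⊆ᵖ? P (next i)) λ nsub → ⊆next (i , nsub))
    (Fin.any? λ i → ¬? (f i ∈ᵗ? M i))

-- If f and g both block, take i with fᵢ ≠ gᵢ.  Then fᵢ lies in the common pair
-- left by g, hence in the list at i+1; it is not in the common pair left by f,
-- so fᵢ = fᵢ₊₁.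
blocks-unique : {M : Fin (suc l) → Triple} {f g : Fin (suc l) → ℕ} →
  (∀ i → f i ≢ f (next i)) → Blocks f M → Blocks g M → ¬ f Differs g
blocks-unique {M = M} {f} {g} proper (f∈M , f-const) (g∈M , g-const) (i , fᵢ≢gᵢ) =
  remove-∉ (M i) (f i)
    (f-const (next i) i
      (remove-keeps (M (next i)) (f (next i)) (f∈M (next i))
        (remove-⊆ (M (next i)) (g (next i))
          (g-const i (next i) (remove-keeps (M i) (g i) (g∈M i) (f∈M i) fᵢ≢gᵢ)))
        (proper i)))

-- At most one coloring of the row blocks the next row, so a second one is tried when the first
-- does.
extend : 1 ≤ l → (P : Fin (suc l) → Pair) → NonConstant P → (M : Fin (suc l) → Triple) →
  ∃[ f ] IsCycleColoring P f × ∃[ Q ] NonConstant Q × Residual M f Q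
-- The function to differ from is arbitrary here: any coloring will do for the first try.
extend {l} 1≤l P nonconst M = first (secondColoring P nonconst (const 0))
  where
  Result : Set
  Result = ∃[ f ] IsCycleColoring P f × ∃[ Q ] NonConstant Q × Residual M f Q
  second : ∀ {f} → Blocks f M → ∃[ g ] IsCycleColoring P g × g Differs f → Result
  second {f} f-blocks (g , g-col , differs) =
    [ (λ res → g , g-col , res)
    , (λ g-blocks → contradiction differs (blocks-unique (proj₂ g-col) g-blocks f-blocks)) ]′
    (residual 1≤l M g)
  first : ∃[ f ] IsCycleColoring P f × f Differs const 0 → Result
  first (f , f-col , _) =
    [ (λ res → f , f-col , res)
    , (λ f-blocks → second f-blocks (secondColoring P nonconst f)) ]′
    (residual 1≤l M f)

fresh : ∀ t → ∃[ x ] ¬ x ∈ᵗ t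
fresh (triple a b c _ _ _) = suc (a + (b + c)) ,
  λ { (inj₁ eq) → <⇒≢ (s≤s (m≤m+n a (b + c))) (sym eq)
    ; (inj₂ (inj₁ eq)) → <⇒≢ (s≤s (≤-trans (m≤m+n b c) (m≤n+m (b + c) a))) (sym eq)
    ; (inj₂ (inj₂ eq)) → <⇒≢ (s≤s (≤-trans (m≤n+m c b) (m≤n+m (b + c) a))) (sym eq) }

-- A fictitious row above, colored throughout with a color outside the first list, cannot block.
initial : 1 ≤ l → (M : Fin (suc l) → Triple) → ∃[ P ] NonConstant P × (∀ i {x} → x ∈ᵖ P i → x ∈ᵗ M i)
initial {l} 1≤l M = go (fresh (M zero))
  where
  go : (∃[ x ] ¬ x ∈ᵗ M zero) → ∃[ P ] NonConstant P × (∀ i {x} → x ∈ᵖ P i → x ∈ᵗ M i)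
  go (x , x∉M) =
    [ (λ (P , nonconst , P⊆M , _) → P , nonconst , P⊆M)
    , (λ (x∈M , _) → contradiction (x∈M zero) x∉M) ]′
    (residual 1≤l M (const x))

-- Coloring a cylinder row by row

RowColoring : ∀ n → (Fin (suc n) → Fin (suc l) → Triple) → (Fin (suc l) → Pair) → Set
RowColoring {l} n M P =
  Σ (Fin (suc n) → Fin (suc l) → ℕ) λ f →
    (∀ i → f zero i ∈ᵖ P i) ×
    (∀ r i → f r i ∈ᵗ M r i) ×
    (∀ r i → f r i ≢ f r (next i)) ×
    (∀ (r : Fin n) i → f (inject₁ r) i ≢ f (suc r) i)

color-rows : 1 ≤ l → ∀ n (M : Fin (suc n) → Fin (suc l) → Triple) (P : Fin (suc l) → Pair) →
  NonConstant P → (∀ i {x} → x ∈ᵖ P i → x ∈ᵗ M zero i) → RowColoring n M P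
color-rows {l} 1≤l zero M P nonconst P⊆M = go (secondColoring P nonconst (const 0))
  where
  go : ∃[ f ] IsCycleColoring P f × f Differs const 0 → RowColoring zero M P
  go (f , (f∈P , proper) , _) =
    (λ _ → f) , f∈P , (λ { zero i → P⊆M i (f∈P i) }) , (λ _ → proper) , λ ()
color-rows {l} 1≤l (suc n) M P nonconst P⊆M = go (extend 1≤l P nonconst (M (suc zero)))
  where
  go : (∃[ f ] IsCycleColoring P f × ∃[ Q ] NonConstant Q × Residual (M (suc zero)) f Q) → RowColoring (suc n) M P
  go (f , (f∈P , proper) , Q , Q-nonconst , Q⊆M , f∉Q) = below (color-rows 1≤l n (M ∘ suc) Q Q-nonconst Q⊆M)
    where
    below : RowColoring n (M ∘ suc) Q → RowColoring (suc n) M P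
    below (g , g∈Q , g∈M , g-proper , g-vert) =
      f ◂ g , f∈P
      , (λ { zero i → P⊆M i (f∈P i) ; (suc r) → g∈M r })
      , (λ { zero → proper ; (suc r) → g-proper r })
      , (λ { zero i eq → f∉Q i (subst (_∈ᵖ Q i) (sym eq) (g∈Q i)) ; (suc r) → g-vert r })

firstThree : (L : List ℕ) → Unique L → 3 ≤ length L → ∃[ t ] (∀ {x} → x ∈ᵗ t → x ∈ L)
firstThree (a ∷ b ∷ c ∷ L) ((a≢b ∷ a≢c ∷ _) ∷ (b≢c ∷ _) ∷ _) _ =
  triple a b c a≢b a≢c b≢c ,
  λ { (inj₁ refl) → here refl ; (inj₂ (inj₁ refl)) → there (here refl)
    ; (inj₂ (inj₂ refl)) → there (there (here refl)) }
firstThree []               _ ()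
firstThree (_ ∷ [])         _ (s≤s ())
firstThree (_ ∷ _ ∷ [])     _ (s≤s (s≤s ()))

rowColoring-proper : (3≤m : 3 ≤ suc l) {n : ℕ} (f : Fin (suc n) → Fin (suc l) → ℕ) →
  (∀ r i → f r i ≢ f r (next i)) → (∀ (r : Fin n) i → f (inject₁ r) i ≢ f (suc r) i) →
  IsProper (cycle (suc l) 3≤m □ path (suc n)) (λ (i , r) → f r i)
rowColoring-proper {l} 3≤m {n} f row column = proper
  where
  row′ : ∀ {i j} r → CyclicSucc (suc l) i j → f r i ≢ f r j
  row′ {i} {j} r ij eq = row r i (trans eq (cong (f r) (cyclicSucc-functional ij (next-succ i))))
  column′ : ∀ {r s : Fin (suc n)} i → toℕ s ≡ suc (toℕ r) → f r i ≢ f s i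
  column′ {r} {suc s} i eq = subst (λ r → f r i ≢ f (suc s) i)
    (Fin.toℕ-injective (trans (Fin.toℕ-inject₁ s) (ℕ.suc-injective eq))) (column s i)
  proper : IsProper (cycle (suc l) 3≤m □ path (suc n)) (λ (i , r) → f r i)
  proper {i , _} (inj₁ (refl , inj₁ p)) = column′ i p
  proper {i , _} (inj₁ (refl , inj₂ p)) = column′ i p ∘ sym
  proper {_ , r} (inj₂ (refl , inj₁ p)) = row′ r p
  proper {_ , r} (inj₂ (refl , inj₂ p)) = row′ r p ∘ sym

cylinder-choosable : ∀ l (3≤m : 3 ≤ suc l) n → Choosable (cycle (suc l) 3≤m □ path (suc n)) 3
cylinder-choosable l 3≤m@(s≤s 2≤l) n L unique 3≤L = go (initial 1≤l (M zero))
  where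
  1≤l : 1 ≤ l
  1≤l = ≤-trans (s≤s z≤n) 2≤l
  three : ∀ v → ∃[ t ] (∀ {x} → x ∈ᵗ t → x ∈ L v)
  three v = firstThree (L v) (unique v) (3≤L v)
  M : Fin (suc n) → Fin (suc l) → Triple
  M r i = proj₁ (three (i , r))
  Result : Set
  Result = ∃[ f ] IsProper (cycle (suc l) 3≤m □ path (suc n)) f × (∀ v → f v ∈ L v)
  rows : ∀ P → RowColoring n M P → Result
  rows P (f , _ , f∈M , row , column) =
    (λ (i , r) → f r i) , rowColoring-proper 3≤m f row column , λ (i , r) → proj₂ (three (i , r)) (f∈M r i)
  go : ∃[ P ] NonConstant P × (∀ i {x} → x ∈ᵖ P i → x ∈ᵗ M zero i) → Result
  go (P , nonconst , P⊆M) = rows P (color-rows 1≤l n M P nonconst P⊆M)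

-- Directed cycles that no other arc enters

odd-+ : ∀ m n → odd (m + n) ≡ odd m xor odd n
odd-+ zero    n = refl
odd-+ (suc m) n = trans (cong not (odd-+ m n)) (not-distribˡ-xor (odd m) (odd n))

2∣?-odd : ∀ n → does (2 ∣? n) ≡ not (odd n)
2∣?-odd zero          = refl
2∣?-odd (suc zero)    = refl
2∣?-odd (suc (suc n)) = trans
  (does-⇔ (mk⇔ (λ p → ∣m+n∣m⇒∣n p ∣-refl) (∣m∣n⇒∣m+n ∣-refl)) (2 ∣? suc (suc n)) (2 ∣? n))
  (trans (2∣?-odd n) (sym (cong not (not-involutive (odd n)))))

sumᵛ-zero : ∀ m {w : Vec Bool m → ℕ} → (∀ b → w b ≡ 0) → sumᵛ _+_ m w ≡ 0
sumᵛ-zero zero    w≡0 = w≡0 []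
sumᵛ-zero (suc m) w≡0 = cong₂ _+_ (sumᵛ-zero m (w≡0 ∘ (true ∷_))) (sumᵛ-zero m (w≡0 ∘ (false ∷_)))

sumᵛ-replicate : ∀ m x {w : Vec Bool m → ℕ} → (∀ b → b ≢ replicate m x → w b ≡ 0) →
  sumᵛ _+_ m w ≡ w (replicate m x)
sumᵛ-replicate zero    x     w≡0 = refl
sumᵛ-replicate (suc m) true  w≡0 = trans
  (cong₂ _+_ (sumᵛ-replicate m true λ b b≢ → w≡0 (true ∷ b) λ { refl → b≢ refl })
             (sumᵛ-zero m λ b → w≡0 (false ∷ b) λ ()))
  (ℕ.+-identityʳ _)
sumᵛ-replicate (suc m) false w≡0 =
  cong₂ _+_ (sumᵛ-zero m λ b → w≡0 (true ∷ b) λ ())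
            (sumᵛ-replicate m false λ b b≢ → w≡0 (false ∷ b) λ { refl → b≢ refl })

select-none : {A : Set} (a : Fin m → A) → select (replicate m false) a ≡ []
select-none {m = zero}  a = refl
select-none {m = suc m} a = select-none (a ∘ suc)

lookup-constant : ∀ (b : Vec Bool m) x → (∀ i → lookup b i ≡ x) → b ≡ replicate m x
lookup-constant []      x b≡x = refl
lookup-constant (y ∷ b) x b≡x = cong₂ _∷_ (b≡x zero) (lookup-constant b x (b≡x ∘ suc))

unique-↭ : {A : Set} {xs ys : List A} → Unique xs → Unique ys → (∀ {x} → x ∈ xs ⇔ x ∈ ys) → xs ↭ ys
unique-↭ ux uy set = ∼bag⇒↭ (unique∧set⇒bag ux uy set)

module _ {V : FiniteSet} (D : Digraph V) where
  open Digraph D using (Arc; arc?; arcs)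

  arcs-unique : Unique arcs
  arcs-unique = filter⁺ (λ (u , v) → arc? u v) (FiniteSet.unique (V ⊗ V))

  ∈-arcs : ∀ {u v} → (u , v) ∈ arcs ⇔ Arc u v
  ∈-arcs {u} {v} = mk⇔
    (λ e → proj₂ (∈-filter⁻ (λ (u , v) → arc? u v) {xs = elements (V ⊗ V)} e))
    (∈-filter⁺ (λ (u , v) → arc? u v) (FiniteSet.complete (V ⊗ V) (u , v)))

module _ (V : FiniteSet) where
  open FiniteSet V using (_≟_)

  circulation-↭ : ∀ {E F} → E ↭ F → IsCirculation V E → IsCirculation V F
  circulation-↭ E↭F circ v = trans (sym (count-↭ (λ a → proj₂ a ≟ v) E↭F))
    (trans (circ v) (count-↭ (λ a → proj₁ a ≟ v) E↭F))

circulations-sum : ∀ {V} (D : Digraph V) {P : ℕ → Set} (P? : ∀ n → Dec (P n)) →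
  length (filter (P? ∘ length) (circulations D)) ≡
  sumˢ (Digraph.arcs D) (λ E → bit (does (isCirculation? V E) ∧ does (P? (length E))))
circulations-sum {V} D P? = trans
  (count-filter (isCirculation? V) (P? ∘ length) (sublists (Digraph.arcs D)))
  (count-sublists (λ E → isCirculation? V E ×-dec P? (length E)) (Digraph.arcs D))

weight-↭ : ∀ V {P : ℕ → Set} (P? : ∀ n → Dec (P n)) {E F} → E ↭ F →
  bit (does (isCirculation? V E) ∧ does (P? (length E))) ≡ bit (does (isCirculation? V F) ∧ does (P? (length F)))
weight-↭ V P? {E} {F} E↭F = cong₂ (λ x n → bit (x ∧ does (P? n)))
  (does-⇔ (mk⇔ (circulation-↭ V E↭F) (circulation-↭ V (↭-sym E↭F)))
    (isCirculation? V E) (isCirculation? V F))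
  (↭-length E↭F)

-- The arcs T i → H i form a cycle, traversed backwards by ρ, that no other arc
-- enters.  A circulation then contains all or none of them.
module IsolatedCycle {V : FiniteSet} (D : Digraph V) (l : ℕ) (even : odd l ≡ false)
  (T H : Fin (suc l) → Carrier V)
  (H-injective : ∀ {i j} → H i ≡ H j → i ≡ j)
  (ρ ρ⁻¹ : Fin (suc l) → Fin (suc l))
  (ρ-ρ⁻¹ : ∀ i → ρ (ρ⁻¹ i) ≡ i)
  (ρ-injective : ∀ {i j} → ρ i ≡ ρ j → i ≡ j)
  (orbit : (P : Fin (suc l) → Set) → (∀ {i} → P i → P (ρ i)) → ∀ {i} j → P i → P j)
  (H-ρ : ∀ i → H (ρ i) ≡ T i)
  (cycle-arc : ∀ i → Digraph.Arc D (T i) (H i))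
  (only-arc : ∀ {u} i → Digraph.Arc D u (H i) → u ≡ T i)
  where
  open Digraph D using (Arc; arcs)
  open FiniteSet V using (_≟_)
  open DecMembership (FiniteSet._≟_ (V ⊗ V)) using (_∈?_)

  a : Fin (suc l) → Carrier V × Carrier V
  a i = T i , H i

  T-injective : ∀ {i j} → T i ≡ T j → i ≡ j
  T-injective {i} {j} eq = ρ-injective (H-injective (trans (H-ρ i) (trans eq (sym (H-ρ j)))))

  rest : List (Carrier V × Carrier V)
  rest = filter (λ e → ¬? (e ∈? tabulate a)) arcs

  -- With the cycle moved to the end, the sum over subdigraphs becomes a double sum, over the other
  -- arcs and over the subsets of the cycle.
  arcs-↭ : arcs ↭ rest ++ tabulate a
  arcs-↭ = unique-↭ (arcs-unique D)
    (++⁺ (filter⁺ _ (arcs-unique D)) (tabulate⁺ {f = a} (λ eq → H-injective (cong proj₂ eq)))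
      (λ (e∈rest , e∈cycle) → proj₂ (∈-filter⁻ (λ e → ¬? (e ∈? tabulate a)) {xs = arcs} e∈rest) e∈cycle))
    (mk⇔ split join)
    where
    split : ∀ {e} → e ∈ arcs → e ∈ rest ++ tabulate a
    split {e} e∈ with e ∈? tabulate a
    ... | yes e∈cycle = ∈-++⁺ʳ rest e∈cycle
    ... | no  e∉cycle = ∈-++⁺ˡ (∈-filter⁺ (λ e → ¬? (e ∈? tabulate a)) e∈ e∉cycle)
    join : ∀ {e} → e ∈ rest ++ tabulate a → e ∈ arcs
    join e∈ with ∈-++⁻ rest e∈
    ... | inj₁ e∈rest  = proj₁ (∈-filter⁻ (λ e → ¬? (e ∈? tabulate a)) {xs = arcs} e∈rest)
    ... | inj₂ e∈cycle with ∈-tabulate⁻ {f = a} e∈cycle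
    ...   | i , refl = Equivalence.from (∈-arcs D) (cycle-arc i)

  rest-head : ∀ {e} i → e ∈ rest → proj₂ e ≢ H i
  rest-head i e∈ refl with ∈-filter⁻ (λ e → ¬? (e ∈? tabulate a)) {xs = arcs} e∈
  ... | e∈arcs , e∉cycle with only-arc i (Equivalence.to (∈-arcs D) e∈arcs)
  ...   | refl = e∉cycle (∈-tabulate⁺ {f = a} i)

  module _ {F : List (Carrier V × Carrier V)} (F⊆rest : ∀ {e} → e ∈ F → e ∈ rest) where

    indegree-cycle : ∀ b i → indegree V (F ++ select b a) (H i) ≡ bit (lookup b i)
    indegree-cycle b i = trans (count-++ (λ e → proj₂ e ≟ H i) F (select b a))
      (cong₂ _+_ (none F F⊆rest) (count-select-one (λ e → proj₂ e ≟ H i) b a i refl (λ j → H-injective)))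
      where
      none : ∀ F → (∀ {e} → e ∈ F → e ∈ rest) → count (λ e → proj₂ e ≟ H i) F ≡ 0
      none []      F⊆ = refl
      none (e ∷ F) F⊆ with proj₂ e ≟ H i
      ... | yes eq = contradiction eq (rest-head i (F⊆ (here refl)))
      ... | no  _  = none F (F⊆ ∘ there)

    outdegree-cycle : ∀ b i → bit (lookup b i) ≤ outdegree V (F ++ select b a) (T i)
    outdegree-cycle b i = subst₂ _≤_
      (count-select-one (λ e → proj₁ e ≟ T i) b a i refl (λ j → T-injective))
      (sym (count-++ (λ e → proj₁ e ≟ T i) F (select b a)))
      (ℕ.m≤n+m _ _)

    -- If arc i is chosen, the outdegree of its tail T i is positive, hence so is the indegree, and
    -- arc ρ i is the only one that enters T i.
    all-or-none : ∀ b → IsCirculation V (F ++ select b a) → ∀ {i} j → lookup b i ≡ true → lookup b j ≡ true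
    all-or-none b circ = orbit (λ i → lookup b i ≡ true) λ {i} bᵢ → positive (subst₂ _≤_ (cong bit bᵢ)
      (trans (sym (circ (T i))) (trans (cong (indegree V (F ++ select b a)) (sym (H-ρ i))) (indegree-cycle b (ρ i))))
      (outdegree-cycle b i))
      where
      positive : ∀ {x} → 1 ≤ bit x → x ≡ true
      positive {true} _ = refl

    module _ {P : ℕ → Set} (P? : ∀ n → Dec (P n)) where

      weight : List (Carrier V × Carrier V) → ℕ
      weight E = bit (does (isCirculation? V E) ∧ does (P? (length E)))

      weight-zero : ∀ E → ¬ IsCirculation V E → weight E ≡ 0
      weight-zero E ¬circ rewrite dec-false (isCirculation? V E) ¬circ = refl

      -- By `all-or-none`, only the two constant selections can give circulations.
      sum-cycle : sumᵛ _+_ (suc l) (λ b → weight (F ++ select b a)) ≡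
        weight (F ++ tabulate a) + weight F
      sum-cycle = cong₂ _+_
        (trans (sumᵛ-replicate l true λ b b≢ → weight-zero (F ++ select (true ∷ b) a) λ circ →
                 b≢ (lookup-constant b true λ i → all-or-none (true ∷ b) circ {zero} (suc i) refl))
               (cong (λ E → weight (F ++ E)) (select-all a)))
        (trans (sumᵛ-replicate l false λ b b≢ → weight-zero (F ++ select (false ∷ b) a) λ circ →
                 b≢ (lookup-constant b false λ i → ¬true (λ bᵢ → contradiction
                   (all-or-none (false ∷ b) circ {suc i} zero bᵢ) λ ())))
               (cong weight (trans (cong (F ++_) (select-none a)) (++-identityʳ F))))
        where
        ¬true : ∀ {x} → x ≢ true → x ≡ false
        ¬true {false} _ = refl
        ¬true {true} t≢t = contradiction refl t≢t

  balanced-cycle : ∀ v → indegree V (tabulate a) v ≡ outdegree V (tabulate a) v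
  balanced-cycle v =
    subst (λ E → indegree V E v ≡ outdegree V E v) (select-all a) (go (Fin.any? λ i → H i ≟ v))
    where
    trues : Vec Bool (suc l)
    trues = replicate (suc l) true
    T-ρ⁻¹ : ∀ i → T (ρ⁻¹ i) ≡ H i
    T-ρ⁻¹ i = trans (sym (H-ρ (ρ⁻¹ i))) (cong H (ρ-ρ⁻¹ i))
    go : Dec (∃[ i ] H i ≡ v) → indegree V (select trues a) v ≡ outdegree V (select trues a) v
    go (yes (i , Hᵢ≡v)) = trans
      (count-select-one (λ e → proj₂ e ≟ v) trues a i Hᵢ≡v λ j Hⱼ≡v → H-injective (trans Hⱼ≡v (sym Hᵢ≡v)))
      (trans (cong bit (trans (lookup-replicate i true) (sym (lookup-replicate (ρ⁻¹ i) true))))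
        (sym (count-select-one (λ e → proj₁ e ≟ v) trues a (ρ⁻¹ i) (trans (T-ρ⁻¹ i) Hᵢ≡v)
          λ j Tⱼ≡v → T-injective (trans Tⱼ≡v (trans (sym Hᵢ≡v) (sym (T-ρ⁻¹ i)))))))
    go (no ∉H) = trans
      (count-select-none (λ e → proj₂ e ≟ v) trues a λ i eq → ∉H (i , eq))
      (sym (count-select-none (λ e → proj₁ e ≟ v) trues a λ i eq → ∉H (ρ i , trans (H-ρ i) eq)))

  circulation-toggle : ∀ F → IsCirculation V (F ++ tabulate a) ⇔ IsCirculation V F
  circulation-toggle F = mk⇔
    (λ circ v → ℕ.+-cancelʳ-≡ (indegree V (tabulate a) v) _ _ (begin
      indegree V F v + indegree V (tabulate a) v   ≡⟨ count-++ (λ e → proj₂ e ≟ v) F (tabulate a) ⟨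
      indegree V (F ++ tabulate a) v               ≡⟨ circ v ⟩
      outdegree V (F ++ tabulate a) v              ≡⟨ count-++ (λ e → proj₁ e ≟ v) F (tabulate a) ⟩
      outdegree V F v + outdegree V (tabulate a) v ≡⟨ cong (outdegree V F v +_) (balanced-cycle v) ⟨
      outdegree V F v + indegree V (tabulate a) v  ∎))
    (λ circ v → begin
      indegree V (F ++ tabulate a) v               ≡⟨ count-++ (λ e → proj₂ e ≟ v) F (tabulate a) ⟩
      indegree V F v + indegree V (tabulate a) v   ≡⟨ cong₂ _+_ (circ v) (balanced-cycle v) ⟩
      outdegree V F v + outdegree V (tabulate a) v ≡⟨ count-++ (λ e → proj₁ e ≟ v) F (tabulate a) ⟨
      outdegree V (F ++ tabulate a) v              ∎)
    where open ≡-Reasoning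

  length-toggle : ∀ F → odd (length (F ++ tabulate a)) ≡ not (odd (length F))
  length-toggle F = begin
    odd (length (F ++ tabulate a))             ≡⟨ cong odd (length-++ F) ⟩
    odd (length F + length (tabulate a))       ≡⟨ odd-+ (length F) _ ⟩
    odd (length F) xor odd (length (tabulate a)) ≡⟨ cong (λ n → odd (length F) xor odd n) (length-tabulate a) ⟩
    odd (length F) xor not (odd l)             ≡⟨ cong (λ x → odd (length F) xor not x) even ⟩
    odd (length F) xor true                    ≡⟨ xor-comm (odd (length F)) true ⟩
    not (odd (length F))                       ∎
    where
    open ≡-Reasoning

  sum-split : {P : ℕ → Set} (P? : ∀ n → Dec (P n)) →
    length (filter (P? ∘ length) (circulations D)) ≡
    sumˢ rest (λ F → sumᵛ _+_ (suc l) λ b →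
      bit (does (isCirculation? V (F ++ select b a)) ∧ does (P? (length (F ++ select b a)))))
  sum-split P? = trans (circulations-sum D P?) (trans (sumˢ-↭ _ (weight-↭ V P?) arcs-↭)
    (trans (sumˢ-++ rest (tabulate a) _) (sumˢ-cong rest λ F _ → sumˢ-tabulate a _)))

  -- Adding the whole cycle preserves balance and, as its length is odd, changes the parity of the
  -- number of arcs. So the two sums agree already for each fixed choice F of the other arcs.
  #even≡#odd : #evenCirculations D ≡ #oddCirculations D
  #even≡#odd = trans (sum-split (2 ∣?_)) (trans
    (sumˢ-cong rest λ F F⊆ → trans (sum-cycle F⊆ (2 ∣?_)) (trans (toggle F) (sym (sum-cycle F⊆ (λ n → ¬? (2 ∣? n))))))
    (sym (sum-split (λ n → ¬? (2 ∣? n)))))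
    where
    toggle : ∀ F →
      bit (does (isCirculation? V (F ++ tabulate a)) ∧ does (2 ∣? length (F ++ tabulate a))) +
      bit (does (isCirculation? V F) ∧ does (2 ∣? length F)) ≡
      bit (does (isCirculation? V (F ++ tabulate a)) ∧ not (does (2 ∣? length (F ++ tabulate a)))) +
      bit (does (isCirculation? V F) ∧ not (does (2 ∣? length F)))
    toggle F rewrite does-⇔ (circulation-toggle F) (isCirculation? V (F ++ tabulate a)) (isCirculation? V F)
      | 2∣?-odd (length (F ++ tabulate a)) | 2∣?-odd (length F) | length-toggle F
      with does (isCirculation? V F) | odd (length F)
    ... | false | _     = refl
    ... | true  | false = refl
    ... | true  | true  = refl

-- Lower bounds

next²-≢ : 3 ≤ suc l → (i : Fin (suc l)) → next (next i) ≢ i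
next²-≢ {l} (s≤s 2≤l) i eq = go (next-succ i) (subst (CyclicSucc (suc l) (next i)) eq (next-succ (next i)))
  where
  go : ∀ {j} → CyclicSucc (suc l) i j → ¬ CyclicSucc (suc l) j i
  go (inj₁ p) (inj₁ q) = contradiction (trans q (cong suc p)) (ℕ.<⇒≢ (s≤s (ℕ.n≤1+n _)))
  go (inj₁ p) (inj₂ (q , r)) = contradiction
    (trans (sym (ℕ.suc-injective q)) (trans p (cong suc r))) (ℕ.>⇒≢ 2≤l)
  go (inj₂ (p , q)) (inj₁ r) = contradiction
    (trans (sym (ℕ.suc-injective p)) (trans r (cong suc q))) (ℕ.>⇒≢ 2≤l)
  go (inj₂ (_ , p)) (inj₂ (q , _)) = contradiction
    (trans (sym (ℕ.suc-injective q)) p) (ℕ.m<n⇒n≢0 2≤l)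

length≤1⇒≡ : {A : Set} {xs : List A} → length xs ≤ 1 → ∀ {x y} → x ∈ xs → y ∈ xs → x ≡ y
length≤1⇒≡ {xs = _ ∷ []} _ (here refl) (here refl) = refl
length≤1⇒≡ {xs = _ ∷ _ ∷ _} (s≤s ())

indegree≤maxIndegree : ∀ {V} (D : Digraph V) v → indegree V (Digraph.arcs D) v ≤ maxIndegree D
indegree≤maxIndegree {V} D v = All.lookup (xs≤max 0 (map (indegree V (Digraph.arcs D)) (elements V)))
  (∈-map⁺ (indegree V (Digraph.arcs D)) (FiniteSet.complete V v))

in-neighbor-unique : ∀ {V} (D : Digraph V) → maxIndegree D ≤ 1 →
  ∀ {u u′ v} → Digraph.Arc D u v → Digraph.Arc D u′ v → u ≡ u′
in-neighbor-unique {V} D max≤1 {u} {u′} {v} uv u′v = cong proj₁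
  (length≤1⇒≡ (ℕ.≤-trans (indegree≤maxIndegree D v) max≤1) (entering uv) (entering u′v))
  where
  entering : ∀ {u} → Digraph.Arc D u v → (u , v) ∈ _
  entering uv = ∈-filter⁺ (λ a → FiniteSet._≟_ V (proj₂ a) v) (Equivalence.from (∈-arcs D) uv) refl

module _ {l n : ℕ} (3≤m : 3 ≤ suc l) (even : odd l ≡ false) where

  private
    G : Graph
    G = cycle (suc l) 3≤m □ path (suc n)

  -- An arc along row 0 forces the next edge to point the same way, since otherwise two arcs would
  -- meet head to head. So row 0 is a directed cycle in one of the two directions, and its vertices
  -- have no room for another entering arc.
  indegree≤1⇒#even≡#odd : (D : Digraph (Graph.V G)) → IsOrientation G D → maxIndegree D ≤ 1 →
    #evenCirculations D ≡ #oddCirculations D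
  indegree≤1⇒#even≡#odd D orient max≤1 = split (arc? (x zero) (x (next zero)))
    where
    open Digraph D using (Arc; arc?)
    open IsOrientation orient
    x : Fin (suc l) → Graph.Vertex G
    x i = i , zero
    x-injective : ∀ {i j} → x i ≡ x j → i ≡ j
    x-injective = cong proj₁
    either : ∀ i → Arc (x i) (x (next i)) ⊎ Arc (x (next i)) (x i)
    either i = Equivalence.to (adj⇔arc (x i) (x (next i))) (inj₂ (refl , inj₁ (next-succ i)))
    forward : ∀ {i} → Arc (x i) (x (next i)) → Arc (x (next i)) (x (next (next i)))
    forward {i} arc = [ id , (λ back → contradiction
      (sym (x-injective (in-neighbor-unique D max≤1 arc back))) (next²-≢ 3≤m i)) ]′ (either (next i))
    split : Dec (Arc (x zero) (x (next zero))) → #evenCirculations D ≡ #oddCirculations D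
    split (yes arc) = IsolatedCycle.#even≡#odd D l even x (x ∘ next)
      (next-injective ∘ x-injective) prev next prev-next
      (λ {i} {j} eq → trans (sym (next-prev i)) (trans (cong next eq) (next-prev j)))
      (λ P step → prev-orbit P (λ {i} p → subst P (prev-next i) (step p)))
      (cong x ∘ next-prev) arcs
      (λ i arc′ → in-neighbor-unique D max≤1 arc′ (arcs i))
      where
      arcs : ∀ i → Arc (x i) (x (next i))
      arcs i = next-orbit (λ i → Arc (x i) (x (next i))) forward i arc
    split (no ¬arc) = IsolatedCycle.#even≡#odd D l even (x ∘ next) x
      x-injective next prev next-prev next-injective
      (λ P step → next-orbit P step)
      (λ _ → refl) arcs
      (λ i arc′ → in-neighbor-unique D max≤1 arc′ (arcs i))
      where
      arcs : ∀ i → Arc (x (next i)) (x i)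
      arcs i =
        -- A single forward arc would spread around the row to the first edge.
        [ (λ arc → contradiction (next-orbit (λ i → Arc (x i) (x (next i))) forward zero arc) ¬arc)
        , id ]′ (either i)

  alonTarsi-lower-bound : ∀ j → HasAlonTarsiOrientation G j → 3 ≤ j
  alonTarsi-lower-bound _ (D , orient , refl , differ) =
    s≤s (ℕ.≰⇒> λ max≤1 → differ (indegree≤1⇒#even≡#odd D orient max≤1))

  -- Row 0 is an odd cycle, and a set of at most two colors embeds into the Booleans.
  colorable-lower-bound : ∀ j → Colorable G j → 3 ≤ j
  colorable-lower-bound j (f , proper) with 3 ≤? j
  ... | yes 3≤j = 3≤j
  ... | no  3≰j = odd-cycle-not-bicolorable even (λ i → isZero (f (i , zero)))
        λ i eq → proper {i , zero} {next i , zero} (inj₂ (refl , inj₁ (next-succ i)))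
          (isZero-injective (ℕ.≤-pred (ℕ.≰⇒> 3≰j)) eq)
    where
    isZero : ∀ {j} → Fin j → Bool
    isZero zero    = true
    isZero (suc _) = false
    isZero-injective : ∀ {j} → j ≤ 2 → {a b : Fin j} → isZero a ≡ isZero b → a ≡ b
    isZero-injective _ {zero} {zero} _ = refl
    isZero-injective (s≤s (s≤s z≤n)) {suc zero} {suc zero} _ = refl

choosable⇒colorable : ∀ G {j} → Choosable G j → Colorable G j
choosable⇒colorable G {j} choosable = go
  (choosable (λ _ → upTo j) (λ _ → upTo⁺ j) (λ _ → ℕ.≤-reflexive (sym (length-upTo j))))
  where
  go : (∃[ f ] IsProper G f × (∀ v → f v ∈ upTo j)) → Colorable G j
  go (f , proper , f∈) = (λ v → fromℕ< (∈-upTo⁻ (f∈ v))) ,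
    λ adj eq → proper adj (trans (sym (Fin.toℕ-fromℕ< _)) (trans (cong toℕ eq) (Fin.toℕ-fromℕ< _)))

chromatic-choosable : ∀ G {c} → Choosable G c → (∀ j → Colorable G j → c ≤ j) → ChromaticChoosable G
chromatic-choosable G {c} choosable lower =
  c , (choosable⇒colorable G choosable , lower) , choosable , λ j → lower j ∘ choosable⇒colorable G

-- The transfer along the rows modulo 2

⊕ : ∀ m → (Vec Bool m → Bool) → Bool
⊕ = sumᵛ _xor_

⊕-cong : ∀ m {f g : Vec Bool m → Bool} → (∀ b → f b ≡ g b) → ⊕ m f ≡ ⊕ m g
⊕-cong zero    f≗g = f≗g []
⊕-cong (suc m) f≗g = cong₂ _xor_ (⊕-cong m (f≗g ∘ (true ∷_))) (⊕-cong m (f≗g ∘ (false ∷_)))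

⊕-xor : ∀ m (f g : Vec Bool m → Bool) → ⊕ m (λ b → f b xor g b) ≡ ⊕ m f xor ⊕ m g
⊕-xor zero    f g = refl
⊕-xor (suc m) f g = trans
  (cong₂ _xor_ (⊕-xor m (f ∘ (true ∷_)) (g ∘ (true ∷_))) (⊕-xor m (f ∘ (false ∷_)) (g ∘ (false ∷_))))
  (xor-interchange (⊕ m _) (⊕ m _) (⊕ m _) (⊕ m _))

⊕-∧ : ∀ m x (f : Vec Bool m → Bool) → ⊕ m (λ b → x ∧ f b) ≡ x ∧ ⊕ m f
⊕-∧ zero    x f = refl
⊕-∧ (suc m) x f = trans
  (cong₂ _xor_ (⊕-∧ m x (f ∘ (true ∷_))) (⊕-∧ m x (f ∘ (false ∷_))))
  (sym (∧-distribˡ-xor x _ _))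

⊕-swap : ∀ m n (f : Vec Bool m → Vec Bool n → Bool) →
  ⊕ m (λ b → ⊕ n (f b)) ≡ ⊕ n (λ c → ⊕ m (λ b → f b c))
⊕-swap zero    n f = refl
⊕-swap (suc m) n f = trans
  (cong₂ _xor_ (⊕-swap m n (f ∘ (true ∷_))) (⊕-swap m n (f ∘ (false ∷_))))
  (sym (⊕-xor n _ _))

⊕₂ : ∀ n m → (Vec (Vec Bool m) n → Bool) → Bool
⊕₂ zero    m f = f []
⊕₂ (suc n) m f = ⊕ m λ b → ⊕₂ n m (f ∘ (b ∷_))

⊕₂-cong : ∀ n {f g : Vec (Vec Bool m) n → Bool} → (∀ b → f b ≡ g b) → ⊕₂ n m f ≡ ⊕₂ n m g
⊕₂-cong zero    f≗g = f≗g []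
⊕₂-cong (suc n) f≗g = ⊕-cong _ λ b → ⊕₂-cong n (f≗g ∘ (b ∷_))

⊕₂-∧ : ∀ n x (f : Vec (Vec Bool m) n → Bool) → ⊕₂ n m (λ b → x ∧ f b) ≡ x ∧ ⊕₂ n m f
⊕₂-∧ zero    x f = refl
⊕₂-∧ {m} (suc n) x f = trans (⊕-cong m λ b → ⊕₂-∧ n x (f ∘ (b ∷_)))
  (⊕-∧ m x (λ b → ⊕₂ n m (f ∘ (b ∷_))))

⊕₂-⊕-swap : ∀ n l (f : Vec (Vec Bool m) n → Vec Bool l → Bool) →
  ⊕₂ n m (λ bs → ⊕ l (f bs)) ≡ ⊕ l (λ c → ⊕₂ n m (λ bs → f bs c))
⊕₂-⊕-swap zero    l f = refl
⊕₂-⊕-swap {m} (suc n) l f = trans (⊕-cong m λ b → ⊕₂-⊕-swap n l (f ∘ (b ∷_)))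
  (⊕-swap m l (λ b c → ⊕₂ n m (λ bs → f (b ∷ bs) c)))

none one : Vec Bool n → Bool
none []       = true
none (x ∷ xs) = not x ∧ none xs
one  []           = false
one  (true  ∷ xs) = none xs
one  (false ∷ xs) = one xs

⊕-none : ∀ n (f : Vec Bool n → Bool) → ⊕ n (λ v → f v ∧ none v) ≡ f (replicate n false)
⊕-none zero    f = ∧-identityʳ (f [])
⊕-none (suc n) f = cong₂ _xor_
  (trans (⊕-cong n λ v → ∧-comm (f (true ∷ v)) false) (⊕-∧ n false (f ∘ (true ∷_))))
  (⊕-none n (f ∘ (false ∷_)))

-- Flow through a single row

balanced : Bool → Bool → Bool → Bool → Bool
balanced s u h v = (bit s + bit u) ≡ᵇ (bit h + bit v)

-- The bits s, hs, e on the horizontal arcs along a row without its column 0,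
-- from left to right, with us and vs on the vertical arcs above and below.
chain : Bool → Vec Bool l → Bool → Vec Bool (suc l) → Vec Bool (suc l) → Bool
chain s []       e (u ∷ []) (v ∷ []) = balanced s u e v
chain s (h ∷ hs) e (u ∷ us) (v ∷ vs) = balanced s u h v ∧ chain h hs e us vs

-- Column 0 is directed upwards, so there u and v change sides.
row : Vec Bool (suc (suc l)) → Vec Bool (suc (suc l)) → Vec Bool (suc (suc l)) → Bool
row (w ∷ h ∷ hs) (u ∷ us) (v ∷ vs) = balanced w v h u ∧ chain h hs w us vs

-- Counts, modulo 2, the flows that start with s on the left, end with e on the right and leave
-- downwards in a way that K accepts.
paths : (Vec Bool (suc l) → Bool) → Bool → Bool → Vec Bool (suc l) → Bool
paths {l} K s e us = ⊕ l λ hs → ⊕ (suc l) λ vs → chain s hs e us vs ∧ K vs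

-- The four terms are the choices of the two bits to the right of the first column and below it.
paths-∷ : (K : Vec Bool (suc (suc l)) → Bool) (s e u : Bool) (us : Vec Bool (suc l)) →
  paths K s e (u ∷ us) ≡
    ((balanced s u true  true ∧ paths (K ∘ (true ∷_)) true  e us) xor
     (balanced s u true  false ∧ paths (K ∘ (false ∷_)) true  e us)) xor
    ((balanced s u false true ∧ paths (K ∘ (true ∷_)) false e us) xor
     (balanced s u false false ∧ paths (K ∘ (false ∷_)) false e us))
paths-∷ {l} K s e u us = cong₂ _xor_ (part true) (part false)
  where
  pull : ∀ x h v →
    ⊕ l (λ hs → ⊕ (suc l) λ vs → (x ∧ chain h hs e us vs) ∧ K (v ∷ vs)) ≡ x ∧ paths (K ∘ (v ∷_)) h e us
  pull x h v = trans
    (⊕-cong l λ hs → trans (⊕-cong (suc l) λ vs → ∧-assoc x (chain h hs e us vs) (K (v ∷ vs)))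
                           (⊕-∧ (suc l) x (λ vs → chain h hs e us vs ∧ K (v ∷ vs))))
    (⊕-∧ l x (λ hs → ⊕ (suc l) λ vs → chain h hs e us vs ∧ K (v ∷ vs)))
  part : ∀ h →
    ⊕ l (λ hs → ⊕ (suc (suc l)) λ vs → chain s (h ∷ hs) e (u ∷ us) vs ∧ K vs) ≡
    (balanced s u h true ∧ paths (K ∘ (true ∷_)) h e us) xor
    (balanced s u h false ∧ paths (K ∘ (false ∷_)) h e us)
  part h = trans (⊕-xor l _ _) (cong₂ _xor_ (pull (balanced s u h true) h true) (pull (balanced s u h false) h false))

paths-false : ∀ s e (us : Vec Bool (suc l)) → paths (const false) s e us ≡ false
paths-false {l} s e us = trans
  (⊕-cong l λ hs → trans (⊕-cong (suc l) λ vs → ∧-comm (chain s hs e us vs) false) (⊕-∧ (suc l) false (const false)))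
  (⊕-∧ l false (const false))

-- Conservation decides this and the next two counts: with nothing leaving downwards, the flow from
-- above amounts to e minus s, and the horizontal bits are then determined.
paths-none-same : ∀ s (us : Vec Bool (suc l)) → paths none s s us ≡ none us
paths-none-FT : (us : Vec Bool (suc l)) → paths none false true us ≡ one us
paths-none-TF : (us : Vec Bool (suc l)) → paths none true false us ≡ false

paths-none-same {zero} false (false ∷ []) = refl
paths-none-same {zero} false (true ∷ [])  = refl
paths-none-same {zero} true  (false ∷ []) = refl
paths-none-same {zero} true  (true ∷ [])  = refl
paths-none-same {suc l} false (false ∷ us)
  rewrite paths-∷ none false false false us = paths-none-same false us
paths-none-same {suc l} false (true ∷ us)
  rewrite paths-∷ none false false true us | paths-none-TF us | paths-false false false us = refl
paths-none-same {suc l} true (false ∷ us)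
  rewrite paths-∷ none true true false us | paths-false false true us =
  trans (xor-identityʳ _) (paths-none-same true us)
paths-none-same {suc l} true (true ∷ us)
  rewrite paths-∷ none true true true us | paths-false true true us = refl

paths-none-FT {zero} (false ∷ []) = refl
paths-none-FT {zero} (true ∷ [])  = refl
paths-none-FT {suc l} (false ∷ us)
  rewrite paths-∷ none false true false us = paths-none-FT us
paths-none-FT {suc l} (true ∷ us)
  rewrite paths-∷ none false true true us | paths-false false true us =
  trans (xor-identityʳ _) (paths-none-same true us)

paths-none-TF {zero} (false ∷ []) = refl
paths-none-TF {zero} (true ∷ [])  = refl
paths-none-TF {suc l} (false ∷ us)
  rewrite paths-∷ none true false false us | paths-false false false us | paths-none-TF us = refl
paths-none-TF {suc l} (true ∷ us)
  rewrite paths-∷ none true false true us | paths-false true false us = refl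

-- The unit entering on the left is the one that leaves below, so nothing can come from above; it
-- may leave in any of the `suc l` columns.
paths-one-TF : (us : Vec Bool (suc l)) → paths one true false us ≡ none us ∧ odd (suc l)
paths-one-TF {zero} (false ∷ []) = refl
paths-one-TF {zero} (true ∷ [])  = refl
paths-one-TF {suc l} (false ∷ us)
  rewrite paths-∷ one true false false us | paths-one-TF us | paths-none-same false us
  with none us | odd l
... | true  | true  = refl
... | true  | false = refl
... | false | _     = refl
paths-one-TF {suc l} (true ∷ us)
  rewrite paths-∷ one true false true us | paths-none-TF us = refl

-- Let flow enter from above at column i and leave below at column j. With 0 on both ends this works
-- exactly for j ≥ i, with 1 on both ends exactly for j ≤ i, in one way each. Together that is one
-- more than the number of columns, namely l + 2.
paths-one-closed : (us : Vec Bool (suc l)) →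
  paths one false false us xor paths one true true us ≡ one us ∧ odd l
paths-one-closed {zero} (false ∷ []) = refl
paths-one-closed {zero} (true ∷ [])  = refl
paths-one-closed {suc l} (false ∷ us) = begin
    paths one false false (false ∷ us) xor paths one true true (false ∷ us)
      ≡⟨ cong₂ _xor_ (paths-∷ one false false false us) (paths-∷ one true true false us) ⟩
    a xor (b xor (paths none false true us xor false))
      ≡⟨ cong (λ x → a xor (b xor x)) (trans (xor-identityʳ _) (paths-none-FT us)) ⟩
    a xor (b xor o)    ≡⟨ xor-assoc a b o ⟨
    (a xor b) xor o    ≡⟨ cong (_xor o) (paths-one-closed us) ⟩
    (o ∧ odd l) xor o  ≡⟨ absorb o (odd l) ⟩
    o ∧ not (odd l)    ∎
  where
  open ≡-Reasoning
  a b o : Bool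
  a = paths one false false us
  b = paths one true true us
  o = one us
  absorb : ∀ x y → (x ∧ y) xor x ≡ x ∧ not y
  absorb true  true  = refl
  absorb true  false = refl
  absorb false y     = refl
paths-one-closed {suc l} (true ∷ us)
  rewrite paths-∷ one false false true us | paths-∷ one true true true us
  | paths-one-TF us | paths-none-same false us | paths-none-same true us
  with none us | odd l
... | true  | true  = refl
... | true  | false = refl
... | false | _     = refl

good : Vec Bool (suc m) → Bool
good (u ∷ us) = u ∧ one us

falses : Vec Bool m
falses = replicate _ false

-- Below the row, column 0 carries flow upwards. If it does so above as well, the horizontal arcs on
-- both sides of column 0 agree and `paths-one-closed` counts. Otherwise the flow turns right in
-- column 0 and has an even number of columns to leave by.
sum-row-good : odd (suc l) ≡ false → (u : Vec Bool (suc (suc l))) →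
  ⊕ (suc (suc l)) (λ b → ⊕ (suc (suc l)) λ c → row b u c ∧ good c) ≡ good u
sum-row-good {l} even (u ∷ us) = trans
  (cong₂ _xor_ (cong₂ _xor_ (part true true) (part true false)) (cong₂ _xor_ (part false true) (part false false)))
  (cases u)
  where
  part : ∀ w h → ⊕ l (λ hs → ⊕ (suc (suc l)) λ c → row (w ∷ h ∷ hs) (u ∷ us) c ∧ good c) ≡
    balanced w true h u ∧ paths one h w us
  part w h = begin
    ⊕ l (λ hs → ⊕ (suc l) (λ vs → (balanced w true h u ∧ chain h hs w us vs) ∧ one vs) xor
                ⊕ (suc l) (λ vs → (balanced w false h u ∧ chain h hs w us vs) ∧ false))
      ≡⟨ ⊕-cong l (λ hs → cong₂ _xor_
           (trans (⊕-cong (suc l) λ vs → ∧-assoc (balanced w true h u) (chain h hs w us vs) (one vs))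
                  (⊕-∧ (suc l) (balanced w true h u) (λ vs → chain h hs w us vs ∧ one vs)))
           (trans (⊕-cong (suc l) λ vs → ∧-comm (balanced w false h u ∧ chain h hs w us vs) false)
                  (⊕-∧ (suc l) false (const false)))) ⟩
    ⊕ l (λ hs → (balanced w true h u ∧ ⊕ (suc l) λ vs → chain h hs w us vs ∧ one vs) xor false)
      ≡⟨ ⊕-cong l (λ hs → xor-identityʳ _) ⟩
    ⊕ l (λ hs → balanced w true h u ∧ ⊕ (suc l) λ vs → chain h hs w us vs ∧ one vs)
      ≡⟨ ⊕-∧ l (balanced w true h u) (λ hs → ⊕ (suc l) λ vs → chain h hs w us vs ∧ one vs) ⟩
    balanced w true h u ∧ paths one h w us ∎
    where open ≡-Reasoning
  cases : ∀ u →
    ((balanced true true true u ∧ paths one true true us) xor (balanced true true false u ∧ paths one false true us)) xor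
    ((balanced false true true u ∧ paths one true false us) xor (balanced false true false u ∧ paths one false false us))
    ≡ u ∧ one us
  cases true = begin
    (paths one true true us xor false) xor paths one false false us
      ≡⟨ cong (_xor paths one false false us) (xor-identityʳ (paths one true true us)) ⟩
    paths one true true us xor paths one false false us
      ≡⟨ xor-comm (paths one true true us) _ ⟩
    paths one false false us xor paths one true true us
      ≡⟨ paths-one-closed us ⟩
    one us ∧ odd l
      ≡⟨ cong (one us ∧_) (trans (sym (not-involutive (odd l))) (cong not even)) ⟩
    one us ∧ true
      ≡⟨ ∧-identityʳ (one us) ⟩
    one us ∎
    where open ≡-Reasoning
  cases false = begin
    paths one true false us xor false ≡⟨ xor-identityʳ _ ⟩
    paths one true false us           ≡⟨ paths-one-TF us ⟩
    none us ∧ odd (suc l)             ≡⟨ cong (none us ∧_) even ⟩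
    none us ∧ false                   ≡⟨ ∧-zeroʳ (none us) ⟩
    false                             ∎
    where open ≡-Reasoning

-- With nothing below, flow from above runs right to the end, wraps around and returns upwards in
-- column 0. The empty layer has two extensions, the empty row and the full directed cycle.
sum-last-row : (u : Vec Bool (suc (suc l))) → ⊕ (suc (suc l)) (λ b → row b u falses) ≡ good u
sum-last-row {l} (u ∷ us) = trans
  (cong₂ _xor_ (cong₂ _xor_ (part true true) (part true false)) (cong₂ _xor_ (part false true) (part false false)))
  (cases u)
  where
  part : ∀ w h → ⊕ l (λ hs → row (w ∷ h ∷ hs) (u ∷ us) falses) ≡ balanced w false h u ∧ paths none h w us
  part w h = trans (⊕-∧ l (balanced w false h u) (λ hs → chain h hs w us falses))
    (cong (balanced w false h u ∧_) (⊕-cong l λ hs → sym (⊕-none (suc l) (chain h hs w us))))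
  cases : ∀ u →
    ((balanced true false true u ∧ paths none true true us) xor (balanced true false false u ∧ paths none false true us)) xor
    ((balanced false false true u ∧ paths none true false us) xor (balanced false false false u ∧ paths none false false us))
    ≡ u ∧ one us
  cases true = trans (xor-identityʳ _) (paths-none-FT us)
  cases false = trans
    (cong₂ _xor_ (trans (xor-identityʳ _) (paths-none-same true us)) (paths-none-same false us))
    (xor-same (none us))

-- Stacking the rows

stack : Vec Bool (suc (suc l)) → Vec (Vec Bool (suc (suc l))) (suc n) → Vec (Vec Bool (suc (suc l))) n → Bool
stack u (b ∷ [])       []       = row b u falses
stack u (b ∷ bs@(_ ∷ _)) (c ∷ cs) = row b u c ∧ stack c bs cs

-- Once the sum over the first layer c is moved outside the sum over the lower rows, these factor
-- off and contribute `good c` by induction, which `sum-row-good` carries up through one more row.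
sum-stack : odd (suc l) ≡ false → ∀ n (u : Vec Bool (suc (suc l))) →
  ⊕₂ (suc n) (suc (suc l)) (λ bs → ⊕₂ n (suc (suc l)) (stack u bs)) ≡ good u
sum-stack even zero u = sum-last-row u
sum-stack {l} even (suc n) u = trans (⊕-cong k λ b → inner b) (sum-row-good even u)
  where
  k : ℕ
  k = suc (suc l)
  open ≡-Reasoning
  factor : ∀ b c (bs : Vec (Vec Bool k) (suc n)) →
    ⊕₂ n k (λ cs → stack u (b ∷ bs) (c ∷ cs)) ≡ row b u c ∧ ⊕₂ n k (stack c bs)
  factor b c bs@(_ ∷ _) = ⊕₂-∧ n (row b u c) (stack c bs)
  inner : ∀ b →
    ⊕₂ (suc n) k (λ bs → ⊕ k λ c → ⊕₂ n k λ cs → stack u (b ∷ bs) (c ∷ cs)) ≡ ⊕ k (λ c → row b u c ∧ good c)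
  inner b = begin
    ⊕₂ (suc n) k (λ bs → ⊕ k λ c → ⊕₂ n k λ cs → stack u (b ∷ bs) (c ∷ cs))
      ≡⟨ ⊕₂-⊕-swap (suc n) k (λ bs c → ⊕₂ n k λ cs → stack u (b ∷ bs) (c ∷ cs)) ⟩
    ⊕ k (λ c → ⊕₂ (suc n) k λ bs → ⊕₂ n k λ cs → stack u (b ∷ bs) (c ∷ cs))
      ≡⟨ ⊕-cong k (λ c → ⊕₂-cong (suc n) (factor b c)) ⟩
    ⊕ k (λ c → ⊕₂ (suc n) k λ bs → row b u c ∧ ⊕₂ n k (stack c bs))
      ≡⟨ ⊕-cong k (λ c → ⊕₂-∧ (suc n) (row b u c) (λ bs → ⊕₂ n k (stack c bs))) ⟩
    ⊕ k (λ c → row b u c ∧ ⊕₂ (suc n) k λ bs → ⊕₂ n k (stack c bs))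
      ≡⟨ ⊕-cong k (λ c → cong (row b u c ∧_) (sum-stack even n c)) ⟩
    ⊕ k (λ c → row b u c ∧ good c) ∎

-- Boolean tests as balance equations

∧-true : ∀ {x y} → x ∧ y ≡ true ⇔ (x ≡ true × y ≡ true)
∧-true {x} {y} = mk⇔ (to x) λ { (refl , refl) → refl }
  where
  to : ∀ x {y} → x ∧ y ≡ true → x ≡ true × y ≡ true
  to true p = refl , p

balanced-true : ∀ s u h v → balanced s u h v ≡ true ⇔ (bit s + bit u ≡ bit h + bit v)
balanced-true s u h v = mk⇔
  (λ p → ≡ᵇ⇒≡ (bit s + bit u) (bit h + bit v) (Equivalence.from T-≡ p))
  (λ p → Equivalence.to T-≡ (≡⇒≡ᵇ (bit s + bit u) (bit h + bit v) p))

chain-true : ∀ s (hs : Vec Bool l) e us vs → chain s hs e us vs ≡ true ⇔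
  (∀ j → bit (lookup (s ∷ hs) j) + bit (lookup us j) ≡ bit (lookup (hs ∷ʳ e) j) + bit (lookup vs j))
chain-true s [] e (u ∷ []) (v ∷ []) = mk⇔
  (λ p → λ { zero → Equivalence.to (balanced-true s u e v) p }) (λ p → Equivalence.from (balanced-true s u e v) (p zero))
chain-true s (h ∷ hs) e (u ∷ us) (v ∷ vs) = mk⇔
  (λ p → let (q , r) = Equivalence.to ∧-true p in λ
    { zero → Equivalence.to (balanced-true s u h v) q ; (suc j) → Equivalence.to (chain-true h hs e us vs) r j })
  (λ p → Equivalence.from ∧-true
    (Equivalence.from (balanced-true s u h v) (p zero) , Equivalence.from (chain-true h hs e us vs) (p ∘ suc)))

RowBalanced : (b u v : Vec Bool (suc (suc l))) → Set
RowBalanced (w ∷ h) us vs =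
  bit w + bit (lookup vs zero) ≡ bit (lookup h zero) + bit (lookup us zero) ×
  (∀ j → bit (lookup h j) + bit (lookup us (suc j)) ≡ bit (lookup (h ∷ʳ w) (suc j)) + bit (lookup vs (suc j)))

row-true : ∀ (b u v : Vec Bool (suc (suc l))) → row b u v ≡ true ⇔ RowBalanced b u v
row-true (w ∷ h ∷ hs) (u ∷ us) (v ∷ vs) = mk⇔
  (λ p → let (q , r) = Equivalence.to ∧-true p in
    Equivalence.to (balanced-true w v h u) q , Equivalence.to (chain-true h hs w us vs) r)
  (λ (q , r) → Equivalence.from ∧-true
    (Equivalence.from (balanced-true w v h u) q , Equivalence.from (chain-true h hs w us vs) r))

stack-true : ∀ u (bs : Vec (Vec Bool (suc (suc l))) (suc n)) cs → stack u bs cs ≡ true ⇔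
  (∀ r → RowBalanced (lookup bs r) (lookup (u ∷ cs) r) (lookup (cs ∷ʳ falses) r))
stack-true u (b ∷ []) [] = mk⇔
  (λ p → λ { zero → Equivalence.to (row-true b u falses) p })
  (λ p → Equivalence.from (row-true b u falses) (p zero))
stack-true u (b ∷ bs@(_ ∷ _)) (c ∷ cs) = mk⇔
  (λ p → let (q , r) = Equivalence.to ∧-true p in λ
    { zero → Equivalence.to (row-true b u c) q ; (suc i) → Equivalence.to (stack-true c bs cs) r i })
  (λ p → Equivalence.from ∧-true
    (Equivalence.from (row-true b u c) (p zero) , Equivalence.from (stack-true c bs cs) (p ∘ suc)))

-- An orientation with an odd number of circulations

lookup-∷ʳ-inject₁ : (xs : Vec A n) (x : A) (i : Fin n) → lookup (xs ∷ʳ x) (inject₁ i) ≡ lookup xs i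
lookup-∷ʳ-inject₁ (_ ∷ xs) x zero    = refl
lookup-∷ʳ-inject₁ (_ ∷ xs) x (suc i) = lookup-∷ʳ-inject₁ xs x i

lookup-∷ʳ-fromℕ : (xs : Vec A n) (x : A) → lookup (xs ∷ʳ x) (fromℕ n) ≡ x
lookup-∷ʳ-fromℕ []       x = refl
lookup-∷ʳ-fromℕ (_ ∷ xs) x = lookup-∷ʳ-fromℕ xs x

count-select-∷ : {P : A → Set} (P? : Decidable P) (x : Bool) (b : Vec Bool m) (a : Fin (suc m) → A) →
  count P? (select (x ∷ b) a) ≡ bit (x ∧ does (P? (a zero))) + count P? (select b (a ∘ suc))
count-select-∷ P? false b a = refl
count-select-∷ P? true  b a = count-∷ P? (a zero) (select b (a ∘ suc))

count-select₂-one : {P : A → Set} (P? : Decidable P) (bs : Vec (Vec Bool m) n) (a : Fin n → Fin m → A)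
  (r : Fin n) (i : Fin m) → P (a r i) → (∀ s j → P (a s j) → s ≡ r × j ≡ i) →
  count P? (select₂ bs a) ≡ bit (lookup (lookup bs r) i)
count-select₂-one P? bs a r i p only = trans
  (count-select₂-row P? bs a r (λ s j q → proj₁ (only s j q)))
  (count-select-one P? (lookup bs r) (a r) i p (λ j q → proj₂ (only r j q)))

-- The appended zeros stand for the absent arcs below the last row, which then needs no formula of
-- its own.
count-select₂-inject₁ : {P : A → Set} (P? : Decidable P) (bs : Vec (Vec Bool m) n) (a : Fin n → Fin m → A)
  (r : Fin (suc n)) (i : Fin m) → (∀ s j → P (a s j) ⇔ (inject₁ s ≡ r × j ≡ i)) →
  count P? (select₂ bs a) ≡ bit (lookup (lookup (bs ∷ʳ falses) r) i)
count-select₂-inject₁ P? bs a r i P⇔ with view r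
... | ‵fromℕ = trans
  (count-select₂-none P? bs a λ s j p → Fin.fromℕ≢inject₁ (sym (proj₁ (Equivalence.to (P⇔ s j) p))))
  (sym (cong bit (trans (cong (λ b → lookup b i) (lookup-∷ʳ-fromℕ bs falses)) (lookup-replicate i false))))
... | ‵inject₁ r′ = trans
  (count-select₂-one P? bs a r′ i (Equivalence.from (P⇔ r′ i) (refl , refl))
    (λ s j p → Fin.inject₁-injective (proj₁ (Equivalence.to (P⇔ s j) p)) , proj₂ (Equivalence.to (P⇔ s j) p)))
  (sym (cong (λ b → bit (lookup b i)) (lookup-∷ʳ-inject₁ bs falses r′)))

∈-table⁺ : (a : Fin n → Fin m → A) → ∀ r i → a r i ∈ table a
∈-table⁺ {suc n} a zero    i = ∈-++⁺ˡ (∈-tabulate⁺ {f = a zero} i)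
∈-table⁺ {suc n} a (suc r) i = ∈-++⁺ʳ (tabulate (a zero)) (∈-table⁺ (a ∘ suc) r i)

∈-table⁻ : (a : Fin n → Fin m → A) → ∀ {x} → x ∈ table a → ∃[ r ] ∃[ i ] x ≡ a r i
∈-table⁻ {suc n} a x∈ with ∈-++⁻ (tabulate (a zero)) x∈
... | inj₁ x∈₀ = zero , ∈-tabulate⁻ {f = a zero} x∈₀
... | inj₂ x∈₁ with ∈-table⁻ (a ∘ suc) x∈₁
...   | r , i , eq = suc r , i , eq

table-unique : (a : Fin n → Fin m → A) → (∀ {r s i j} → a r i ≡ a s j → r ≡ s × i ≡ j) → Unique (table a)
table-unique {zero}  a inj = []
table-unique {suc n} a inj = ++⁺
  (tabulate⁺ {f = a zero} (λ eq → proj₂ (inj eq)))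
  (table-unique (a ∘ suc) (λ eq → let (p , q) = inj eq in Fin.suc-injective p , q))
  λ (x∈₀ , x∈₁) → disjoint (∈-tabulate⁻ {f = a zero} x∈₀) (∈-table⁻ (a ∘ suc) x∈₁)
  where
  disjoint : ∀ {x} → (∃[ i ] x ≡ a zero i) → (∃[ r ] ∃[ i ] x ≡ a (suc r) i) → ⊥
  disjoint (i , refl) (r , j , eq) with () ← proj₁ (inj eq)

odd-bit : ∀ x → odd (bit x) ≡ x
odd-bit true  = refl
odd-bit false = refl

odd-sumᵛ : ∀ m (f : Vec Bool m → ℕ) → odd (sumᵛ _+_ m f) ≡ ⊕ m (odd ∘ f)
odd-sumᵛ zero    f = refl
odd-sumᵛ (suc m) f = trans (odd-+ (sumᵛ _+_ m (f ∘ (true ∷_))) _)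
  (cong₂ _xor_ (odd-sumᵛ m (f ∘ (true ∷_))) (odd-sumᵛ m (f ∘ (false ∷_))))

odd-sumˢ-table : (a : Fin n → Fin m → A) (f : List A → ℕ) →
  odd (sumˢ (table a) f) ≡ ⊕₂ n m (λ b → odd (f (select₂ b a)))
odd-sumˢ-table {zero}      a f = refl
odd-sumˢ-table {suc n} {m} a f = begin
  odd (sumˢ (tabulate (a zero) ++ table (a ∘ suc)) f)
    ≡⟨ cong odd (sumˢ-++ (tabulate (a zero)) (table (a ∘ suc)) f) ⟩
  odd (sumˢ (tabulate (a zero)) λ E → sumˢ (table (a ∘ suc)) λ F → f (E ++ F))
    ≡⟨ cong odd (sumˢ-tabulate (a zero) _) ⟩
  odd (sumᵛ _+_ m λ b → sumˢ (table (a ∘ suc)) λ F → f (select b (a zero) ++ F))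
    ≡⟨ odd-sumᵛ m _ ⟩
  ⊕ m (λ b → odd (sumˢ (table (a ∘ suc)) λ F → f (select b (a zero) ++ F)))
    ≡⟨ ⊕-cong m (λ b → odd-sumˢ-table (a ∘ suc) _) ⟩
  ⊕₂ (suc n) m (λ b → odd (f (select₂ b a))) ∎
  where open ≡-Reasoning

flip₀ : Vec (Vec Bool (suc m)) (suc n) → Vec (Vec Bool (suc m)) (suc n)
flip₀ ((w ∷ b) ∷ bs) = (not w ∷ b) ∷ bs

-- Toggling the outermost bit only exchanges the two halves of the sum.
⊕₂-flip₀ : (f : Vec (Vec Bool (suc m)) (suc n) → Bool) → ⊕₂ (suc n) (suc m) (f ∘ flip₀) ≡ ⊕₂ (suc n) (suc m) f
⊕₂-flip₀ {m} {n} f = xor-comm (⊕ m λ b → ⊕₂ n (suc m) (λ bs → f ((false ∷ b) ∷ bs))) _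

count-complement : {P : A → Set} (P? : Decidable P) (xs : List A) →
  count P? xs + count (¬? ∘ P?) xs ≡ length xs
count-complement P? [] = refl
count-complement P? (x ∷ xs) with does (P? x)
... | true  = cong suc (count-complement P? xs)
... | false = trans (ℕ.+-suc (count P? xs) _) (cong suc (count-complement P? xs))

-- Row 0 is directed from left to right, also on the edge between its ends; every
-- other row is a directed cycle.  Column 0 is directed upwards, the others downwards.
module Orientation (l n : ℕ) (1≤l : 1 ≤ l) where

  V : FiniteSet
  V = finiteFin (suc (suc l)) ⊗ finiteFin (suc n)
  open FiniteSet V using (_≟_; complete)

  Edge : Set
  Edge = Carrier V × Carrier V

  top : Fin (suc (suc l))
  top = fromℕ (suc l)

  wrapArc : Fin (suc n) → Edge
  wrapArc zero    = (zero , zero) , (top , zero)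
  wrapArc (suc r) = (top , suc r) , (zero , suc r)

  -- In the cyclic rows, index i belongs to the arc that enters column i; in row 0, index zero is
  -- the reversed arc.
  hArc : Fin (suc n) → Fin (suc (suc l)) → Edge
  hArc r zero    = wrapArc r
  hArc r (suc j) = (inject₁ j , r) , (suc j , r)

  vArc : Fin n → Fin (suc (suc l)) → Edge
  vArc r zero    = (zero , suc r) , (zero , inject₁ r)
  vArc r (suc j) = (suc j , inject₁ r) , (suc j , suc r)

  edges : List Edge
  edges = table hArc ++ table vArc

  inject₁≢suc : ∀ {k} (i : Fin k) → inject₁ i ≢ suc i
  inject₁≢suc i eq = ℕ.1+n≢n (sym (trans (sym (Fin.toℕ-inject₁ i)) (cong toℕ eq)))

  inject₁-suc-asym : ∀ {k} {i j : Fin k} → inject₁ i ≡ suc j → ¬ (suc i ≡ inject₁ j)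
  inject₁-suc-asym {i = i} {j} p q = ℕ.<-asym
    (ℕ.≤-reflexive (sym (trans (sym (Fin.toℕ-inject₁ i)) (cong toℕ p))))
    (ℕ.≤-reflexive (trans (cong toℕ q) (Fin.toℕ-inject₁ j)))

  -- As there are at least three columns, the edge between the end columns never coincides with an
  -- edge between consecutive ones.
  narrow : ∀ {j : Fin (suc l)} → top ≡ suc j → ¬ (zero ≡ inject₁ j)
  narrow {j} p q = ℕ.m<n⇒n≢0 1≤l (trans (sym (Fin.toℕ-fromℕ l))
    (trans (cong toℕ (Fin.suc-injective p)) (trans (sym (Fin.toℕ-inject₁ j)) (sym (cong toℕ q)))))

  hArc-head-row : ∀ r i → proj₂ (proj₂ (hArc r i)) ≡ r
  hArc-head-row zero    zero    = refl
  hArc-head-row (suc r) zero    = refl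
  hArc-head-row r       (suc i) = refl

  hArc-tail-row : ∀ r i → proj₂ (proj₁ (hArc r i)) ≡ r
  hArc-tail-row zero    zero    = refl
  hArc-tail-row (suc r) zero    = refl
  hArc-tail-row r       (suc i) = refl

  vArc-rows : ∀ r i → proj₂ (proj₁ (vArc r i)) ≢ proj₂ (proj₂ (vArc r i))
  vArc-rows r zero    eq = inject₁≢suc r (sym eq)
  vArc-rows r (suc i) eq = inject₁≢suc r eq

  hArc≢vArc : ∀ r i s j → hArc r i ≢ vArc s j
  hArc≢vArc r i s j eq = vArc-rows s j (subst (λ e → proj₂ (proj₁ e) ≡ proj₂ (proj₂ e)) eq
    (trans (hArc-tail-row r i) (sym (hArc-head-row r i))))

  hArc-injective : ∀ {r s i j} → hArc r i ≡ hArc s j → r ≡ s × i ≡ j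
  hArc-injective {r} {s} {i} {j} eq
    with trans (sym (hArc-head-row r i)) (trans (cong (proj₂ ∘ proj₂) eq) (hArc-head-row s j))
  ... | refl = refl , columns r i j eq
    where
    columns : ∀ r i j → hArc r i ≡ hArc r j → i ≡ j
    columns r       zero    zero    eq = refl
    columns zero    zero    (suc j) eq = contradiction (cong (proj₁ ∘ proj₁) eq) (narrow (cong (proj₁ ∘ proj₂) eq))
    columns zero    (suc i) zero    eq = contradiction (cong (proj₁ ∘ proj₁) (sym eq)) (narrow (cong (proj₁ ∘ proj₂) (sym eq)))
    columns (suc r) zero    (suc j) eq with () ← cong (proj₁ ∘ proj₂) eq
    columns (suc r) (suc i) zero    eq with () ← cong (proj₁ ∘ proj₂) eq
    columns r       (suc i) (suc j) eq = cong (proj₁ ∘ proj₂) eq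

  vArc-injective : ∀ {r s i j} → vArc r i ≡ vArc s j → r ≡ s × i ≡ j
  vArc-injective {i = zero}  {zero}  eq = Fin.suc-injective (cong (proj₂ ∘ proj₁) eq) , refl
  vArc-injective {i = zero}  {suc j} eq with () ← cong (proj₁ ∘ proj₁) eq
  vArc-injective {i = suc i} {zero}  eq with () ← cong (proj₁ ∘ proj₁) eq
  vArc-injective {i = suc i} {suc j} eq = Fin.suc-injective (cong (proj₂ ∘ proj₂) eq) , cong (proj₁ ∘ proj₁) eq

  edges-unique : Unique edges
  edges-unique = ++⁺ (table-unique hArc hArc-injective) (table-unique vArc vArc-injective)
    λ (e∈h , e∈v) → disjoint (∈-table⁻ hArc e∈h) (∈-table⁻ vArc e∈v)
    where
    disjoint : ∀ {e} → (∃[ r ] ∃[ i ] e ≡ hArc r i) → (∃[ r ] ∃[ i ] e ≡ vArc r i) → ⊥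
    disjoint (r , i , refl) (s , j , eq) = hArc≢vArc r i s j eq

  ∈-edges⁻ : ∀ {e} → e ∈ edges → (∃[ r ] ∃[ i ] e ≡ hArc r i) ⊎ (∃[ r ] ∃[ i ] e ≡ vArc r i)
  ∈-edges⁻ e∈ = [ (λ p → inj₁ (∈-table⁻ hArc p)) , (λ p → inj₂ (∈-table⁻ vArc p)) ]′ (∈-++⁻ (table hArc) e∈)

  h∈edges : ∀ r i → hArc r i ∈ edges
  h∈edges r i = ∈-++⁺ˡ (∈-table⁺ hArc r i)

  v∈edges : ∀ r i → vArc r i ∈ edges
  v∈edges r i = ∈-++⁺ʳ (table hArc) (∈-table⁺ vArc r i)

  hArc-asym : ∀ r i j → hArc r i ≢ reverse (hArc r j)
  hArc-asym zero    zero    zero    eq with () ← cong (proj₁ ∘ proj₁) eq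
  hArc-asym (suc r) zero    zero    eq with () ← cong (proj₁ ∘ proj₁) eq
  hArc-asym zero    zero    (suc j) eq with () ← cong (proj₁ ∘ proj₁) eq
  hArc-asym zero    (suc i) zero    eq with () ← cong (proj₁ ∘ proj₂) eq
  hArc-asym (suc r) zero    (suc j) eq = narrow (cong (proj₁ ∘ proj₁) eq) (cong (proj₁ ∘ proj₂) eq)
  hArc-asym (suc r) (suc i) zero    eq = narrow (sym (cong (proj₁ ∘ proj₂) eq)) (sym (cong (proj₁ ∘ proj₁) eq))
  hArc-asym r       (suc i) (suc j) eq = inject₁-suc-asym (cong (proj₁ ∘ proj₁) eq) (cong (proj₁ ∘ proj₂) eq)

  vArc-asym : ∀ r s i j → vArc r i ≢ reverse (vArc s j)
  vArc-asym r s zero    zero    eq = inject₁-suc-asym (cong (proj₂ ∘ proj₂) eq) (cong (proj₂ ∘ proj₁) eq)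
  vArc-asym r s zero    (suc j) eq with () ← cong (proj₁ ∘ proj₁) eq
  vArc-asym r s (suc i) zero    eq with () ← cong (proj₁ ∘ proj₁) eq
  vArc-asym r s (suc i) (suc j) eq = inject₁-suc-asym (cong (proj₂ ∘ proj₁) eq) (cong (proj₂ ∘ proj₂) eq)

  edges-asym : ∀ {u v} → (u , v) ∈ edges → ¬ (v , u) ∈ edges
  edges-asym uv vu = go (∈-edges⁻ uv) (∈-edges⁻ vu)
    where
    go : ∀ {u v} → (∃[ r ] ∃[ i ] (u , v) ≡ hArc r i) ⊎ (∃[ r ] ∃[ i ] (u , v) ≡ vArc r i) →
      ¬ ((∃[ r ] ∃[ i ] (v , u) ≡ hArc r i) ⊎ (∃[ r ] ∃[ i ] (v , u) ≡ vArc r i))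
    go (inj₁ (r , i , p)) (inj₁ (s , j , q))
      with trans (sym (hArc-head-row r i)) (trans (cong (proj₂ ∘ proj₂) (trans (sym p) (cong reverse q))) (hArc-tail-row s j))
    ... | refl = hArc-asym r i j (trans (sym p) (cong reverse q))
    go (inj₁ (r , i , refl)) (inj₂ (s , j , q)) = vArc-rows s j
      (subst (λ e → proj₂ (proj₁ e) ≡ proj₂ (proj₂ e)) q (trans (hArc-head-row r i) (sym (hArc-tail-row r i))))
    go (inj₂ (r , i , q)) (inj₁ (s , j , refl)) = vArc-rows r i
      (subst (λ e → proj₂ (proj₁ e) ≡ proj₂ (proj₂ e)) q (trans (hArc-head-row s j) (sym (hArc-tail-row s j))))
    go (inj₂ (r , i , p)) (inj₂ (s , j , q)) = vArc-asym r s i j (trans (sym p) (cong reverse q))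

  D : Digraph V
  D = record
    { Arc    = λ u v → (u , v) ∈ edges
    ; arc?   = λ u v → (u , v) ∈? edges
    ; irrefl = λ v vv → edges-asym vv vv
    }
    where open DecMembership (FiniteSet._≟_ (V ⊗ V)) using (_∈?_)

  arcs-↭ : Digraph.arcs D ↭ edges
  arcs-↭ = unique-↭ (arcs-unique D) edges-unique (∈-arcs D)

  isOrientation : (3≤m : 3 ≤ suc (suc l)) → IsOrientation (cycle (suc (suc l)) 3≤m □ path (suc n)) D
  isOrientation 3≤m = record
    { adj⇔arc = λ u v → mk⇔ to λ { (inj₁ uv) → from (∈-edges⁻ uv) ; (inj₂ vu) → G.symm (from (∈-edges⁻ vu)) }
    ; asym = edges-asym
    }
    where
    module G = Graph (cycle (suc (suc l)) 3≤m □ path (suc n))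
    Arc : Carrier V → Carrier V → Set
    Arc u v = (u , v) ∈ edges
    column : ∀ i s → Arc (i , inject₁ s) (i , suc s) ⊎ Arc (i , suc s) (i , inject₁ s)
    column zero    s = inj₂ (v∈edges s zero)
    column (suc i) s = inj₁ (v∈edges s (suc i))
    row-arc : ∀ r j → Arc (prev j , r) (j , r) ⊎ Arc (j , r) (prev j , r)
    row-arc zero    zero    = inj₂ (h∈edges zero zero)
    row-arc (suc r) zero    = inj₁ (h∈edges (suc r) zero)
    row-arc r       (suc j) = inj₁ (h∈edges r (suc j))
    column′ : ∀ {i r s} → toℕ s ≡ suc (toℕ r) → Arc (i , r) (i , s) ⊎ Arc (i , s) (i , r)
    column′ {i} {r} {suc s} eq = subst (λ r → Arc (i , r) (i , suc s) ⊎ Arc (i , suc s) (i , r))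
      (Fin.toℕ-injective (trans (Fin.toℕ-inject₁ s) (ℕ.suc-injective eq))) (column i s)
    row′ : ∀ {i j r} → CyclicSucc (suc (suc l)) i j → Arc (i , r) (j , r) ⊎ Arc (j , r) (i , r)
    row′ {i} {j} {r} ij = subst (λ i → Arc (i , r) (j , r) ⊎ Arc (j , r) (i , r))
      (cyclicSucc-injective (prev-succ j) ij) (row-arc r j)
    to : ∀ {u v} → G.Adj u v → Arc u v ⊎ Arc v u
    to (inj₁ (refl , inj₁ p)) = column′ p
    to (inj₁ (refl , inj₂ p)) = ⊎-swap (column′ p)
    to (inj₂ (refl , inj₁ p)) = row′ p
    to (inj₂ (refl , inj₂ p)) = ⊎-swap (row′ p)
    from : ∀ {u v} → (∃[ r ] ∃[ i ] (u , v) ≡ hArc r i) ⊎ (∃[ r ] ∃[ i ] (u , v) ≡ vArc r i) → G.Adj u v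
    from (inj₁ (zero  , zero  , refl)) = inj₂ (refl , inj₂ (prev-succ zero))
    from (inj₁ (suc r , zero  , refl)) = inj₂ (refl , inj₁ (prev-succ zero))
    from (inj₁ (r     , suc j , refl)) = inj₂ (refl , inj₁ (prev-succ (suc j)))
    from (inj₂ (r , zero  , refl)) = inj₁ (refl , inj₂ (cong suc (sym (Fin.toℕ-inject₁ r))))
    from (inj₂ (r , suc j , refl)) = inj₁ (refl , inj₁ (cong suc (sym (Fin.toℕ-inject₁ r))))

  -- Degrees in a chosen subdigraph

  in? out? : (v : Carrier V) → Decidable {A = Edge} _
  in?  v e = proj₂ e ≟ v
  out? v e = proj₁ e ≟ v

  chosen : Vec (Vec Bool (suc (suc l))) (suc n) → Vec (Vec Bool (suc (suc l))) n → List Edge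
  chosen bs cs = select₂ bs hArc ++ select₂ cs vArc

  in-right : ∀ r j (h : Vec Bool (suc l)) → count (in? (suc j , r)) (select h (hArc r ∘ suc)) ≡ bit (lookup h j)
  in-right r j h = count-select-one (in? (suc j , r)) h (hArc r ∘ suc) j refl
    (λ i eq → Fin.suc-injective (cong proj₁ eq))

  in-right-zero : ∀ r (h : Vec Bool (suc l)) → count (in? (zero , r)) (select h (hArc r ∘ suc)) ≡ 0
  in-right-zero r h = count-select-none (in? (zero , r)) h (hArc r ∘ suc) λ i ()

  out-right : ∀ r i (h : Vec Bool (suc l)) →
    count (out? (i , r)) (select h (hArc r ∘ suc)) ≡ bit (lookup (h ∷ʳ false) i)
  out-right r i h with view i
  ... | ‵fromℕ = trans
    (count-select-none (out? (top , r)) h (hArc r ∘ suc) (λ j eq → Fin.fromℕ≢inject₁ (sym (cong proj₁ eq))))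
    (sym (cong bit (lookup-∷ʳ-fromℕ h false)))
  ... | ‵inject₁ j = trans
    (count-select-one (out? (inject₁ j , r)) h (hArc r ∘ suc) j refl
      (λ i eq → Fin.inject₁-injective (cong proj₁ eq)))
    (sym (cong bit (lookup-∷ʳ-inject₁ h false j)))

  -- The wrapping arc of a cyclic row leaves the last column, so w takes the place that is vacant
  -- there.
  last-bit : ∀ w (h : Vec Bool (suc l)) j →
    bit (w ∧ does (top Fin.≟ suc j)) + bit (lookup (h ∷ʳ false) (suc j)) ≡ bit (lookup (h ∷ʳ w) (suc j))
  last-bit w h j with view j
  ... | ‵fromℕ rewrite dec-true (top Fin.≟ top) refl
    | lookup-∷ʳ-fromℕ h false | lookup-∷ʳ-fromℕ h w | ∧-identityʳ w = ℕ.+-identityʳ _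
  ... | ‵inject₁ i rewrite dec-false (top Fin.≟ inject₁ (suc i)) Fin.fromℕ≢inject₁
    | lookup-∷ʳ-inject₁ h false (suc i) | lookup-∷ʳ-inject₁ h w (suc i) | ∧-zeroʳ w = refl

  module _ (bs : Vec (Vec Bool (suc (suc l))) (suc n)) (cs : Vec (Vec Bool (suc (suc l))) n) where

    private
      E : List Edge
      E = chosen bs cs

    indegree-row : ∀ i r {w h} → lookup bs r ≡ w ∷ h → indegree V E (i , r) ≡
      (bit (w ∧ does (in? (i , r) (wrapArc r))) + count (in? (i , r)) (select h (hArc r ∘ suc))) +
      count (in? (i , r)) (select₂ cs vArc)
    indegree-row i r {w} {h} eq = trans (count-++ (in? (i , r)) (select₂ bs hArc) (select₂ cs vArc))
      (cong (_+ count (in? (i , r)) (select₂ cs vArc))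
        (trans (count-select₂-row (in? (i , r)) bs hArc r
                 (λ s j p → trans (sym (hArc-head-row s j)) (cong proj₂ p)))
          (trans (cong (λ b → count (in? (i , r)) (select b (hArc r))) eq)
            (count-select-∷ (in? (i , r)) w h (hArc r)))))

    outdegree-row : ∀ i r {w h} → lookup bs r ≡ w ∷ h → outdegree V E (i , r) ≡
      (bit (w ∧ does (out? (i , r) (wrapArc r))) + bit (lookup (h ∷ʳ false) i)) +
      count (out? (i , r)) (select₂ cs vArc)
    outdegree-row i r {w} {h} eq = trans (count-++ (out? (i , r)) (select₂ bs hArc) (select₂ cs vArc))
      (cong (_+ count (out? (i , r)) (select₂ cs vArc))
        (trans (count-select₂-row (out? (i , r)) bs hArc r
                 (λ s j p → trans (sym (hArc-tail-row s j)) (cong proj₂ p)))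
          (trans (cong (λ b → count (out? (i , r)) (select b (hArc r))) eq)
            (trans (count-select-∷ (out? (i , r)) w h (hArc r))
              (cong (bit (w ∧ does (out? (i , r) (wrapArc r))) +_) (out-right r i h))))))

    above : Fin n → Fin (suc (suc l)) → ℕ
    above r i = bit (lookup (lookup cs r) i)

    below : Fin (suc n) → Fin (suc (suc l)) → ℕ
    below r i = bit (lookup (lookup (cs ∷ʳ falses) r) i)

    in-column-zero : ∀ r → count (in? (zero , r)) (select₂ cs vArc) ≡ below r zero
    in-column-zero r = count-select₂-inject₁ (in? (zero , r)) cs vArc r zero
      (λ s → λ { zero → mk⇔ (λ eq → cong proj₂ eq , refl) (λ { (refl , _) → refl })
               ; (suc j) → mk⇔ (λ ()) λ () })

    out-column-suc : ∀ r j → count (out? (suc j , r)) (select₂ cs vArc) ≡ below r (suc j)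
    out-column-suc r j = count-select₂-inject₁ (out? (suc j , r)) cs vArc r (suc j)
      (λ s → λ { zero → mk⇔ (λ ()) λ ()
               ; (suc i) → mk⇔ (λ eq → cong proj₂ eq , cong proj₁ eq) (λ { (refl , refl) → refl }) })

    out-column-zero-zero : count (out? (zero , zero)) (select₂ cs vArc) ≡ 0
    out-column-zero-zero = count-select₂-none (out? (zero , zero)) cs vArc (λ { s zero () ; s (suc j) () })

    in-column-suc-zero : ∀ j → count (in? (suc j , zero)) (select₂ cs vArc) ≡ 0
    in-column-suc-zero j = count-select₂-none (in? (suc j , zero)) cs vArc (λ { s zero () ; s (suc j) () })

    out-column-zero-suc : ∀ r → count (out? (zero , suc r)) (select₂ cs vArc) ≡ above r zero
    out-column-zero-suc r = count-select₂-one (out? (zero , suc r)) cs vArc r zero refl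
      (λ { s zero eq → Fin.suc-injective (cong proj₂ eq) , refl ; s (suc j) () })

    in-column-suc-suc : ∀ r j → count (in? (suc j , suc r)) (select₂ cs vArc) ≡ above r (suc j)
    in-column-suc-suc r j = count-select₂-one (in? (suc j , suc r)) cs vArc r (suc j) refl
      (λ { s zero () ; s (suc i) eq → Fin.suc-injective (cong proj₂ eq) , cong proj₁ eq })

    wrap-out : ∀ r j → does (out? (suc j , suc r) (wrapArc (suc r))) ≡ does (top Fin.≟ suc j)
    wrap-out r j = does-⇔ (mk⇔ (cong proj₁) (cong (_, suc r))) (out? (suc j , suc r) (wrapArc (suc r))) (top Fin.≟ suc j)

    wrap-in : ∀ j → does (in? (suc j , zero) (wrapArc zero)) ≡ does (top Fin.≟ suc j)
    wrap-in j = does-⇔ (mk⇔ (cong proj₁) (cong (_, zero))) (in? (suc j , zero) (wrapArc zero)) (top Fin.≟ suc j)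

    indegree-zero-suc : ∀ r {w h} → lookup bs (suc r) ≡ w ∷ h →
      indegree V E (zero , suc r) ≡ bit w + below (suc r) zero
    indegree-zero-suc r {w} {h} eq = trans (indegree-row zero (suc r) eq)
      (cong₂ _+_ (trans (cong₂ _+_
          (trans (cong (λ x → bit (w ∧ x)) (dec-true (in? (zero , suc r) (wrapArc (suc r))) refl))
                 (cong bit (∧-identityʳ w)))
          (in-right-zero (suc r) h)) (ℕ.+-identityʳ _))
        (in-column-zero (suc r)))

    outdegree-zero-suc : ∀ r {w h} → lookup bs (suc r) ≡ w ∷ h →
      outdegree V E (zero , suc r) ≡ bit (lookup h zero) + above r zero
    outdegree-zero-suc r {w} {h} eq = trans (outdegree-row zero (suc r) eq)
      (cong₂ _+_ (cong₂ _+_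
          (trans (cong (λ x → bit (w ∧ x)) (dec-false (out? (zero , suc r) (wrapArc (suc r))) λ ()))
                 (cong bit (∧-zeroʳ w)))
          (cong bit (lookup-∷ʳ-inject₁ h false zero)))
        (out-column-zero-suc r))

    indegree-suc-suc : ∀ j r {w h} → lookup bs (suc r) ≡ w ∷ h →
      indegree V E (suc j , suc r) ≡ bit (lookup h j) + above r (suc j)
    indegree-suc-suc j r {w} {h} eq = trans (indegree-row (suc j) (suc r) eq)
      (cong₂ _+_ (cong₂ _+_
          (trans (cong (λ x → bit (w ∧ x)) (dec-false (in? (suc j , suc r) (wrapArc (suc r))) λ ()))
                 (cong bit (∧-zeroʳ w)))
          (in-right (suc r) j h))
        (in-column-suc-suc r j))

    outdegree-suc-suc : ∀ j r {w h} → lookup bs (suc r) ≡ w ∷ h →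
      outdegree V E (suc j , suc r) ≡ bit (lookup (h ∷ʳ w) (suc j)) + below (suc r) (suc j)
    outdegree-suc-suc j r {w} {h} eq = trans (outdegree-row (suc j) (suc r) eq)
      (cong₂ _+_ (trans (cong (λ x → bit (w ∧ x) + bit (lookup (h ∷ʳ false) (suc j))) (wrap-out r j)) (last-bit w h j))
        (out-column-suc (suc r) j))

    indegree-zero-zero : ∀ {w h} → lookup bs zero ≡ w ∷ h → indegree V E (zero , zero) ≡ below zero zero
    indegree-zero-zero {w} {h} eq = trans (indegree-row zero zero eq)
      (cong₂ _+_ (cong₂ _+_
          (trans (cong (λ x → bit (w ∧ x)) (dec-false (in? (zero , zero) (wrapArc zero)) λ ()))
                 (cong bit (∧-zeroʳ w)))
          (in-right-zero zero h))
        (in-column-zero zero))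

    outdegree-zero-zero : ∀ {w h} → lookup bs zero ≡ w ∷ h →
      outdegree V E (zero , zero) ≡ bit w + bit (lookup h zero)
    outdegree-zero-zero {w} {h} eq = trans (outdegree-row zero zero eq) (trans
      (cong₂ _+_ (cong₂ _+_
          (trans (cong (λ x → bit (w ∧ x)) (dec-true (out? (zero , zero) (wrapArc zero)) refl))
                 (cong bit (∧-identityʳ w)))
          (cong bit (lookup-∷ʳ-inject₁ h false zero)))
        out-column-zero-zero)
      (ℕ.+-identityʳ _))

    indegree-suc-zero : ∀ j {w h} → lookup bs zero ≡ w ∷ h →
      indegree V E (suc j , zero) ≡ bit (w ∧ does (top Fin.≟ suc j)) + bit (lookup h j)
    indegree-suc-zero j {w} {h} eq = trans (indegree-row (suc j) zero eq) (trans
      (cong₂ _+_ (cong₂ _+_ (cong (λ x → bit (w ∧ x)) (wrap-in j)) (in-right zero j h)) (in-column-suc-zero j))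
      (ℕ.+-identityʳ _))

    outdegree-suc-zero : ∀ j {w h} → lookup bs zero ≡ w ∷ h →
      outdegree V E (suc j , zero) ≡ bit (lookup (h ∷ʳ false) (suc j)) + below zero (suc j)
    outdegree-suc-zero j {w} {h} eq = trans (outdegree-row (suc j) zero eq)
      (cong₂ _+_ (cong₂ _+_
          (trans (cong (λ x → bit (w ∧ x)) (dec-false (out? (suc j , zero) (wrapArc zero)) λ ()))
                 (cong bit (∧-zeroʳ w)))
          refl)
        (out-column-suc zero j))

  -- Reversing the edge between the ends of row 0 makes that row a directed cycle
  -- too, with virtual arcs above columns 0 and top that carry flow.
  boundary : Vec Bool (suc (suc l))
  boundary = true ∷ (falses ∷ʳ true)

  lookup-boundary : ∀ j → lookup boundary (suc j) ≡ does (top Fin.≟ suc j)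
  lookup-boundary j with view j
  ... | ‵fromℕ = trans (lookup-∷ʳ-fromℕ (falses {l}) true) (sym (dec-true (top Fin.≟ top) refl))
  ... | ‵inject₁ i = trans (lookup-∷ʳ-inject₁ falses true i)
    (trans (lookup-replicate i false) (sym (dec-false (top Fin.≟ inject₁ (suc i)) Fin.fromℕ≢inject₁)))

  -- Add `bit (not w)` to both sides: an outflow of w becomes an inflow of 1 - w together with a
  -- constant outflow of 1, the first bit of `boundary`.
  reverse-at-0 : ∀ w x y → x ≡ bit w + y ⇔ (bit (not w) + x ≡ y + 1)
  reverse-at-0 true  x y = mk⇔ (λ p → trans p (ℕ.+-comm 1 y)) (λ p → trans p (ℕ.+-comm y 1))
  reverse-at-0 false x y = mk⇔ (λ p → trans (cong suc p) (ℕ.+-comm 1 y))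
    (λ p → ℕ.suc-injective (trans p (ℕ.+-comm y 1)))

  -- The same exchange at the other end of the reversed arc; in the columns between, neither this
  -- arc nor `boundary` contributes.
  reverse-at-suc : ∀ w (h : Vec Bool (suc l)) j y →
    (bit (w ∧ does (top Fin.≟ suc j)) + bit (lookup h j) ≡ bit (lookup (h ∷ʳ false) (suc j)) + y) ⇔
    (bit (lookup h j) + bit (lookup boundary (suc j)) ≡ bit (lookup (h ∷ʳ not w) (suc j)) + y)
  reverse-at-suc w h j y rewrite lookup-boundary j with view j
  ... | ‵fromℕ rewrite dec-true (top Fin.≟ top) refl
    | lookup-∷ʳ-fromℕ h false | lookup-∷ʳ-fromℕ h (not w) | ∧-identityʳ w = last w
    where
    x : ℕ
    x = bit (lookup h (fromℕ l))
    last : ∀ w → bit w + x ≡ y ⇔ (x + 1 ≡ bit (not w) + y)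
    last true  = mk⇔ (trans (ℕ.+-comm x 1)) (trans (ℕ.+-comm 1 x))
    last false = mk⇔ (λ p → trans (ℕ.+-comm x 1) (cong suc p)) (λ p → ℕ.suc-injective (trans (ℕ.+-comm 1 x) p))
  ... | ‵inject₁ i rewrite dec-false (top Fin.≟ inject₁ (suc i)) Fin.fromℕ≢inject₁
    | lookup-∷ʳ-inject₁ h false (suc i) | lookup-∷ʳ-inject₁ h (not w) (suc i) | ∧-zeroʳ w
    | ℕ.+-identityʳ (bit (lookup h (inject₁ i))) = mk⇔ id id

  module _ (bs : Vec (Vec Bool (suc (suc l))) (suc n)) (cs : Vec (Vec Bool (suc (suc l))) n) where

    BalancedAt : Carrier V → Set
    BalancedAt v = indegree V (chosen bs cs) v ≡ outdegree V (chosen bs cs) v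

    row-suc : ∀ r b → lookup bs (suc r) ≡ b → (∀ i → BalancedAt (i , suc r)) ⇔
      RowBalanced b (lookup cs r) (lookup (cs ∷ʳ falses) (suc r))
    row-suc r (w ∷ h) eq = mk⇔
      (λ p → trans (sym (indegree-zero-suc bs cs r eq)) (trans (p zero) (outdegree-zero-suc bs cs r eq))
           , λ j → trans (sym (indegree-suc-suc bs cs j r eq)) (trans (p (suc j)) (outdegree-suc-suc bs cs j r eq)))
      (λ (p , q) → λ
        { zero    → trans (indegree-zero-suc bs cs r eq) (trans p (sym (outdegree-zero-suc bs cs r eq)))
        ; (suc j) → trans (indegree-suc-suc bs cs j r eq) (trans (q j) (sym (outdegree-suc-suc bs cs j r eq))) })

    row-zero : ∀ w h → lookup bs zero ≡ w ∷ h → (∀ i → BalancedAt (i , zero)) ⇔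
      RowBalanced (not w ∷ h) boundary (lookup (cs ∷ʳ falses) zero)
    row-zero w h eq = mk⇔
      (λ p → Equivalence.to (reverse-at-0 w _ _)
               (trans (sym (indegree-zero-zero bs cs eq)) (trans (p zero) (outdegree-zero-zero bs cs eq)))
           , λ j → Equivalence.to (reverse-at-suc w h j _)
               (trans (sym (indegree-suc-zero bs cs j eq)) (trans (p (suc j)) (outdegree-suc-zero bs cs j eq))))
      (λ (p , q) → λ
        { zero    → trans (indegree-zero-zero bs cs eq)
            (trans (Equivalence.from (reverse-at-0 w _ _) p) (sym (outdegree-zero-zero bs cs eq)))
        ; (suc j) → trans (indegree-suc-zero bs cs j eq)
            (trans (Equivalence.from (reverse-at-suc w h j _) (q j)) (sym (outdegree-suc-zero bs cs j eq))) })

  circulation⇔stack : ∀ bs cs → IsCirculation V (chosen bs cs) ⇔ (stack boundary (flip₀ bs) cs ≡ true)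
  circulation⇔stack bs@((w ∷ h) ∷ bs′) cs = mk⇔
    (λ circ → Equivalence.from (stack-true boundary (flip₀ bs) cs) λ
      { zero    → Equivalence.to (row-zero bs cs w h refl) λ i → circ (i , zero)
      ; (suc r) → Equivalence.to (row-suc bs cs r _ refl) λ i → circ (i , suc r) })
    (λ p → let rows = Equivalence.to (stack-true boundary (flip₀ bs) cs) p in λ
      { (i , zero)  → Equivalence.from (row-zero bs cs w h refl) (rows zero) i
      ; (i , suc r) → Equivalence.from (row-suc bs cs r _ refl) (rows (suc r)) i })

  circulation-stack : ∀ bs cs → does (isCirculation? V (chosen bs cs)) ≡ stack boundary (flip₀ bs) cs
  circulation-stack bs cs = go (isCirculation? V (chosen bs cs))
    where
    go : (circ? : Dec (IsCirculation V (chosen bs cs))) → does circ? ≡ stack boundary (flip₀ bs) cs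
    go (yes circ) = sym (Equivalence.to (circulation⇔stack bs cs) circ)
    go (no ¬circ) = sym (¬-not (¬circ ∘ Equivalence.from (circulation⇔stack bs cs)))

  one-boundary : ∀ k → one (falses {k} ∷ʳ true) ≡ true
  one-boundary zero    = refl
  one-boundary (suc k) = one-boundary k

  odd-circulations : odd (suc l) ≡ false → odd (length (circulations D)) ≡ true
  odd-circulations even = begin
    odd (length (circulations D))
      ≡⟨ cong odd (count-sublists (isCirculation? V) (Digraph.arcs D)) ⟩
    odd (sumˢ (Digraph.arcs D) circ)
      ≡⟨ cong odd (sumˢ-↭ circ circ-↭ arcs-↭) ⟩
    odd (sumˢ edges circ)
      ≡⟨ cong odd (sumˢ-++ (table hArc) (table vArc) circ) ⟩
    odd (sumˢ (table hArc) λ E → sumˢ (table vArc) λ F → circ (E ++ F))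
      ≡⟨ odd-sumˢ-table hArc (λ E → sumˢ (table vArc) λ F → circ (E ++ F)) ⟩
    ⊕₂ (suc n) k (λ bs → odd (sumˢ (table vArc) λ F → circ (select₂ bs hArc ++ F)))
      ≡⟨ ⊕₂-cong {k} (suc n) (λ bs → odd-sumˢ-table vArc λ F → circ (select₂ bs hArc ++ F)) ⟩
    ⊕₂ (suc n) k (λ bs → ⊕₂ n k λ cs → odd (circ (chosen bs cs)))
      ≡⟨ ⊕₂-cong {k} (suc n) (λ bs → ⊕₂-cong {k} n λ cs →
           trans (odd-bit (does (isCirculation? V (chosen bs cs)))) (circulation-stack bs cs)) ⟩
    ⊕₂ (suc n) k (λ bs → ⊕₂ n k λ cs → stack boundary (flip₀ bs) cs)
      ≡⟨ ⊕₂-flip₀ (λ bs → ⊕₂ n k λ cs → stack boundary bs cs) ⟩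
    ⊕₂ (suc n) k (λ bs → ⊕₂ n k λ cs → stack boundary bs cs)
      ≡⟨ sum-stack even n boundary ⟩
    -- This is `good boundary`, reduced: the virtual layer uses column 0 and one other column.
    one (falses {l} ∷ʳ true)
      ≡⟨ one-boundary l ⟩
    true ∎
    where
    open ≡-Reasoning
    k : ℕ
    k = suc (suc l)
    circ : List Edge → ℕ
    circ = indicator ∘ isCirculation? V
    circ-↭ : ∀ {E F} → E ↭ F → circ E ≡ circ F
    circ-↭ {E} {F} E↭F = cong bit (does-⇔
      (mk⇔ (circulation-↭ V E↭F) (circulation-↭ V (↭-sym E↭F))) (isCirculation? V E) (isCirculation? V F))

  #even≢#odd : odd (suc l) ≡ false → #evenCirculations D ≢ #oddCirculations D
  #even≢#odd even eq = contradiction (begin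
    true                          ≡⟨ odd-circulations even ⟨
    odd (length (circulations D)) ≡⟨ cong odd (count-complement (λ E → 2 ∣? length E) (circulations D)) ⟨
    odd (#evenCirculations D + #oddCirculations D) ≡⟨ odd-+ (#evenCirculations D) _ ⟩
    odd (#evenCirculations D) xor odd (#oddCirculations D) ≡⟨ cong (λ k → odd (#evenCirculations D) xor odd k) eq ⟨
    odd (#evenCirculations D) xor odd (#evenCirculations D) ≡⟨ xor-same (odd (#evenCirculations D)) ⟩
    false ∎) λ ()
    where open ≡-Reasoning

  -- With every bit true, the degree formulas for subdigraphs apply to the whole orientation.
  all-arcs : ∀ v → indegree V (Digraph.arcs D) v ≡
    indegree V (chosen (replicate _ (replicate _ true)) (replicate _ (replicate _ true))) v
  all-arcs v = trans (count-↭ (in? v) arcs-↭)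
    (cong (count (in? v)) (sym (cong₂ _++_ (select₂-all hArc) (select₂-all vArc))))

  bit≤1 : ∀ x → bit x ≤ 1
  bit≤1 true  = s≤s z≤n
  bit≤1 false = z≤n

  indegree≤2 : ∀ v → indegree V (Digraph.arcs D) v ≤ 2
  indegree≤2 v = subst (_≤ 2) (sym (all-arcs v)) (bound v)
    where
    bs : Vec (Vec Bool (suc (suc l))) (suc n)
    bs = replicate _ (replicate _ true)
    cs : Vec (Vec Bool (suc (suc l))) n
    cs = replicate _ (replicate _ true)
    row-eq : ∀ r → lookup bs r ≡ true ∷ replicate _ true
    row-eq r = lookup-replicate r _
    bound : ∀ v → indegree V (chosen bs cs) v ≤ 2
    bound (zero , zero) = ℕ.≤-trans (ℕ.≤-reflexive (indegree-zero-zero bs cs (row-eq zero)))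
      (ℕ.≤-trans (bit≤1 _) (s≤s z≤n))
    bound (suc j , zero) = ℕ.≤-trans (ℕ.≤-reflexive (indegree-suc-zero bs cs j (row-eq zero)))
      (ℕ.+-mono-≤ (bit≤1 (does (top Fin.≟ suc j))) (bit≤1 _))
    bound (zero , suc r) = ℕ.≤-trans (ℕ.≤-reflexive (indegree-zero-suc bs cs r (row-eq (suc r))))
      (ℕ.+-mono-≤ (bit≤1 true) (bit≤1 _))
    bound (suc j , suc r) = ℕ.≤-trans (ℕ.≤-reflexive (indegree-suc-suc bs cs j r (row-eq (suc r))))
      (ℕ.+-mono-≤ (bit≤1 (lookup (replicate (suc l) true) j)) (bit≤1 _))

  -- The last vertex of row 0 is entered by its left neighbor and by the reversed arc, so the bound
  -- 2 is attained even if there is only one row.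
  indegree-top : indegree V (Digraph.arcs D) (top , zero) ≡ 2
  indegree-top = trans (all-arcs (top , zero)) (trans
    (indegree-suc-zero (replicate _ (replicate _ true)) (replicate _ (replicate _ true)) (fromℕ l) refl)
    (cong₂ (λ x y → bit x + bit y) (dec-true (top Fin.≟ top) refl) (lookup-replicate (fromℕ l) true)))

  maxIndegree≡2 : maxIndegree D ≡ 2
  maxIndegree≡2 = max≈v⁺
    (subst (_∈ map (indegree V (Digraph.arcs D)) (elements V)) indegree-top
      (∈-map⁺ (indegree V (Digraph.arcs D)) (complete (top , zero))))
    (map⁺ (All.universal indegree≤2 (elements V)))
    z≤n

  alonTarsi-orientation : (3≤m : 3 ≤ suc (suc l)) → odd (suc l) ≡ false →
    HasAlonTarsiOrientation (cycle (suc (suc l)) 3≤m □ path (suc n)) 3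
  alonTarsi-orientation 3≤m even = D , isOrientation 3≤m , cong suc maxIndegree≡2 , #even≢#odd even

odd-double : ∀ k → odd (k + k) ≡ false
odd-double zero    = refl
odd-double (suc k) rewrite ℕ.+-suc k k | not-involutive (odd (k + k)) = odd-double k

-- The length is a variable with an equation because `2 * k + 1` does not compute to a successor, so
-- `refl` could not match it directly.
odd-cylinder : ∀ m (3≤m : 3 ≤ m) l → m ≡ suc l → odd l ≡ false → ∀ n → 1 ≤ n →
  IsAlonTarsiNumber (cycle m 3≤m □ path n) 3 × ChromaticChoosable (cycle m 3≤m □ path n)
odd-cylinder _ 3≤m@(s≤s (s≤s 1≤l)) (suc l) refl even (suc n) _ =
  (Orientation.alonTarsi-orientation l n 1≤l 3≤m even , alonTarsi-lower-bound 3≤m even) ,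
  chromatic-choosable (cycle _ 3≤m □ path (suc n)) (cylinder-choosable (suc l) 3≤m n) (colorable-lower-bound 3≤m even)

theorem4 : (k n : ℕ) (1≤k : 1 ≤ k) → 1 ≤ n →
    IsAlonTarsiNumber (cycle (2 * k + 1) (3≤2k+1 1≤k) □ path n) 3
    × ChromaticChoosable (cycle (2 * k + 1) (3≤2k+1 1≤k) □ path n)
theorem4 k n 1≤k 1≤n = odd-cylinder (2 * k + 1) (3≤2k+1 1≤k) (2 * k) (ℕ.+-comm (2 * k) 1)
  (trans (cong (λ j → odd (k + j)) (ℕ.+-identityʳ k)) (odd-double k)) n 1≤n
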